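{- Let $r\ge1$ and let $b_1\ge\cdots\ge b_r$ be integers with $b_i\ge i$ for all $i$. Let $M=b_1-1$ and let $\mathbf u=(u_1,\dots,u_M)$ be commuting indeterminates. The multivariate descent enumerator $$\mathcal D_{\mathbf b}(\mathbf u)=\sum_{w\in\mathcal W_{\mathbf b}}\prod_{j\in D(w)}u_j$$ is coefficientwise positive (nonnegative integer coefficients), and the $q$-Zeta numerator of the Ferrers-cell poset $F_{\mathbf b}$ is its principal specialization $$\mathbb{H}_{F_{\mathbf b},\rho}(q,t)=\mathcal D_{\mathbf b}(t,tq,tq^2,\dots,tq^{M-1}).$$ More generally, for an interval $I=[x,y]$ of $F_{\mathbf b}$ of length $h\ge1$, with $x=(i,c)<y=(j,d)$ and $h=(i-j)+(d-c)$, the local descent enumerator $$\mathcal D_I(\mathbf u)=\sum_{w\in\mathcal W_{\mathbf b}(x,y)}\ \prod_{p\in D_{x,y}(w)}u_p$$ in the variables $u_1,\dots,u_{h-1}$ specializes to $$\mathbb{H}_{I,\rho_{x,y}}(q,t)=\mathcal D_I(tq,tq^2,\dots,tq^{h-1}),$$ where $\rho_{x,y}(z)=\rho(z)-\rho(x)$.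
   Context: $q$-Zeta numerator: let $P$ be a finite graded poset with a unique maximum and rank function $\rho:P\to\{0,\dots,H\}$, where $H$ is the maximal rank. For $m\ge 0$ put $A_m(P,\rho;q)=\sum_{x_1\le\cdots\le x_m}q^{\rho(x_1)+\cdots+\rho(x_m)}$ (sum over weak chains in $P$; $A_0=1$). The numerator $\mathbb{H}_{P,\rho}(q,t)$ is the polynomial determined by $\sum_{m\ge 0}A_m(P,\rho;q)t^m=\mathbb{H}_{P,\rho}(q,t)/\prod_{a=0}^{H}(1-q^at)$. Ferrers-cell poset: $F_{\mathbf b}=\{(i,c):1\le i\le r,\ i\le c\le b_i\}$, ordered by $(i,c)\le(j,d)\iff i\ge j$ and $c\le d$, with rank $\rho(i,c)=c-i$. Global words: for $w\in\{L,R\}^M$ let $\ell(w)$ be its number of $L$'s and $\iota(w)=\ell(w)+1$. $\mathcal W_{\mathbf b}$ is the set of $w\in\{L,R\}^M$ with $\ell(w)\le r-1$ such that for every prefix, with $L_k$ letters $L$ and $R_k$ letters $R$, $\iota(w)+R_k\le b_{\iota(w)-L_k}$. $D(w)=\{j: w_j=L\text{ and }(j=1\text{ or }w_{j-1}=R)\}$. Local words: $\mathcal W_{\mathbf b}(x,y)$ is the set of words with exactly $i-j$ letters $L$ and $d-c$ letters $R$ such that every prefix with $L_k$ letters $L$ and $R_k$ letters $R$ satisfies $c+R_k\le b_{i-L_k}$; $D_{x,y}(w)=\{p\in\{1,\dots,h-1\}:w_p=R,\ w_{p+1}=L\}$. -}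

module Defs where

open import Algebra.Bundles.Raw using (RawRing)
import Algebra.Definitions.RawSemiring as RawSemiringOps
open import Data.Bool.Base using (if_then_else_)
open import Data.Fin.Base using (Fin; zero; suc; toℕ)
open import Data.Fin.Properties using (all?; any?)
open import Data.Integer.Base as ℤ using (ℤ; +_; -[1+_])
open import Data.List.Base as List
  using (List; []; _∷_; _++_; foldr; filter; length; upTo; allFin;
         cartesianProduct; cartesianProductWith)
open import Data.List.Extrema.Nat using (max)
import Data.List.Membership.Setoid as Membership
open import Data.List.Membership.Propositional.Properties
  using (∈-upTo⁺; ∈-cartesianProduct⁺)
open import Data.List.Relation.Unary.All as All using (All; []; _∷_)
open import Data.List.Relation.Unary.AllPairs using ([]; _∷_)
open import Data.List.Relation.Unary.Any using (here; there)
import Data.List.Relation.Unary.Unique.Setoid as UniqueSetoid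
import Data.List.Relation.Unary.Unique.Propositional.Properties as Unique
open import Data.Nat.Base using (ℕ; zero; suc; _+_; _∸_; _≤_; _≥_; _<_; z≤n; s≤s)
open import Data.Nat.Properties as ℕ using (_≤?_)
open import Data.Product.Base using (Σ; ∃; _×_; _,_; proj₁; proj₂)
open import Data.Product.Properties using (≡-dec)
open import Data.Sum.Base using (_⊎_; inj₁; inj₂)
open import Data.Vec.Base as Vec using (Vec; []; _∷_; lookup; replicate; toList; zipWith; _[_]≔_)
open import Data.Vec.Properties as Vec using ()
open import Data.Vec.Relation.Unary.Linked using (Linked; linked?)
open import Function.Base using (_∘_; _on_)
open import Level using (0ℓ)
open import Relation.Binary.Bundles using (DecPoset; Setoid)
import Relation.Binary.Construct.NonStrictToStrict as ToStrict
import Relation.Binary.Construct.On as On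
open import Relation.Binary.Definitions using (DecidableEquality; Maximum)
open import Relation.Binary.Structures using (IsDecPartialOrder)
open import Relation.Binary.PropositionalEquality
  using (_≡_; refl; sym; trans; cong; cong₂; subst; isEquivalence)
open import Relation.Nullary.Decidable using (Dec; yes; no; does; _×-dec_; _⊎-dec_)
open import Relation.Nullary.Negation using (¬_; contradiction)
open import Relation.Unary using (Pred; Decidable)

module RingOps (R : RawRing 0ℓ 0ℓ) where
  open RawRing R public using (Carrier; _≈_; 0#; 1#; -_)
    renaming (_+_ to infixl 6 _⊕_; _*_ to infixl 7 _⊗_)
  open RawSemiringOps (RawRing.rawSemiring R) public using (_^_)
    renaming (_×_ to _·_)

  infix 5 ∑ ∏

  ∑ ∏ : {I : Set} → List I → (I → Carrier) → Carrier
  ∑ is f = foldr (λ i s → f i ⊕ s) 0# is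
  ∏ is f = foldr (λ i s → f i ⊗ s) 1# is

  syntax ∑ is (λ i → e) = ∑[ i ∈ is ] e
  syntax ∏ is (λ i → e) = ∏[ i ∈ is ] e

  fromℤ : ℤ → Carrier
  fromℤ (+ n)    = n · 1#
  fromℤ -[1+ n ] = - (suc n · 1#)

-- Polynomials over ℤ in n commuting variables, as finite lists of terms
-- (coefficient , exponent vector).  A monomial may occur repeatedly;
-- polynomials are compared through their collected coefficients.

Poly : ℕ → Set
Poly n = List (ℤ × Vec ℕ n)

coeff : ∀ {n} → Poly n → Vec ℕ n → ℤ
coeff []            e = + 0
coeff ((c , d) ∷ p) e =
  (if does (Vec.≡-dec ℕ._≟_ d e) then c else + 0) ℤ.+ coeff p e

polyRing : ℕ → RawRing 0ℓ 0ℓ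
polyRing n = record
  { Carrier = Poly n
  ; _≈_     = λ f g → ∀ e → coeff f e ≡ coeff g e
  ; _+_     = _++_
  ; _*_     = cartesianProductWith λ (c , d) (c′ , d′) → c ℤ.* c′ , zipWith _+_ d d′
  ; -_      = List.map λ (c , d) → ℤ.- c , d
  ; 0#      = []
  ; 1#      = (+ 1 , replicate n 0) ∷ []
  }

var : ∀ {n} → Fin n → Poly n
var {n} i = (+ 1 , replicate n 0 [ i ]≔ 1) ∷ []

NonnegativeCoefficients : ∀ {n} → Poly n → Set
NonnegativeCoefficients f = ∀ e → + 0 ℤ.≤ coeff f e

module _ (R : RawRing 0ℓ 0ℓ) where
  open RingOps R

  eval : ∀ {n} → Poly n → (Fin n → Carrier) → Carrier
  eval {n} f v = ∑[ (c , d) ∈ f ] fromℤ c ⊗ (∏[ i ∈ allFin n ] v i ^ lookup d i)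

ℤ[q] ℤ[q,t] : RawRing 0ℓ 0ℓ
ℤ[q]   = polyRing 1
ℤ[q,t] = polyRing 2

q t : Poly 2
q = var zero
t = var (suc zero)

series : RawRing 0ℓ 0ℓ → RawRing 0ℓ 0ℓ
series R = record
  { Carrier = ℕ → Carrier
  ; _≈_     = λ f g → ∀ n → f n ≈ g n
  ; _+_     = λ f g n → f n ⊕ g n
  ; _*_     = λ f g n → ∑[ k ∈ upTo (suc n) ] f k ⊗ g (n ∸ k)
  ; -_      = λ f n → - f n
  ; 0#      = λ _ → 0#
  ; 1#      = λ { zero → 1# ; (suc _) → 0# }
  }
  where open RingOps R

-- The coefficient of qᵏ tᵐ in f is f m k.
ℤ⟦q⟧⟦t⟧ : RawRing 0ℓ 0ℓ
ℤ⟦q⟧⟦t⟧ = series (series ℤ.+-*-rawRing)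

⟦_⟧ : Poly 2 → RawRing.Carrier ℤ⟦q⟧⟦t⟧
⟦ f ⟧ m k = coeff f (k ∷ m ∷ [])

record GradedPoset : Set₁ where
  field
    decPoset : DecPoset 0ℓ 0ℓ 0ℓ

  open DecPoset decPoset public using (Carrier; _≈_; module Eq)
    renaming (_≤_ to infix 4 _≼_; _≤?_ to infix 4 _≼?_)
  open ToStrict _≈_ _≼_ public using () renaming (_<_ to infix 4 _≺_)
  open Membership Eq.setoid using (_∈_)
  open UniqueSetoid Eq.setoid using (Unique)

  _⋖_ : Carrier → Carrier → Set
  x ⋖ y = x ≺ y × (∀ z → x ≼ z → z ≼ y → z ≈ x ⊎ z ≈ y)

  field
    elements          : List Carrier
    elements-complete : ∀ x → x ∈ elements
    elements-unique   : Unique elements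
    top               : Carrier
    top-maximum       : Maximum _≼_ top
    rank              : Carrier → ℕ
    rank-minimal      : ∀ x → (∀ z → z ≼ x → z ≈ x) → rank x ≡ 0
    rank-cover        : ∀ x y → x ⋖ y → rank y ≡ suc (rank x)

  maxRank : ℕ
  maxRank = max 0 (List.map rank elements)

tuples : {A : Set} → List A → ∀ m → List (Vec A m)
tuples xs zero    = [] ∷ []
tuples xs (suc m) = cartesianProductWith _∷_ xs (tuples xs m)

module _ (P : GradedPoset) where
  open GradedPoset P using (elements; _≼?_; rank; maxRank)

  weakChains : ∀ m → List (Vec (GradedPoset.Carrier P) m)
  weakChains m = filter (linked? _≼?_) (tuples elements m)

  A : ℕ → Poly 1
  A m = ∑[ x ∈ weakChains m ] var zero ^ Vec.sum (Vec.map rank x)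
    where open RingOps ℤ[q]

  ∑Aₘtᵐ : RawRing.Carrier ℤ⟦q⟧⟦t⟧
  ∑Aₘtᵐ m k = coeff (A m) (k ∷ [])

  denominator : Poly 2
  denominator = ∏[ a ∈ upTo (suc maxRank) ] (1# ⊕ - (q ^ a ⊗ t))
    where open RingOps ℤ[q,t]

  -- f is the polynomial with  ∑ₘ Aₘ tᵐ = f / ∏ₐ (1 - qᵃ t).  The
  -- denominator is a unit of ℤ⟦q⟧⟦t⟧, so it can be cleared.
  IsNumerator : Poly 2 → Set
  IsNumerator f = RawRing._≈_ ℤ⟦q⟧⟦t⟧ (RawRing._*_ ℤ⟦q⟧⟦t⟧ ∑Aₘtᵐ ⟦ denominator ⟧) ⟦ f ⟧

  numerator-unique : ∀ f g → IsNumerator f → IsNumerator g → RawRing._≈_ ℤ[q,t] f g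
  numerator-unique f g F G (k ∷ m ∷ []) = trans (sym (F m k)) (G m k)

module _ {A : Set} {Q : Pred A 0ℓ} (Q? : Decidable Q) where

  restrict : List A → List (Σ A Q)
  restrict []       = []
  restrict (x ∷ xs) with Q? x
  ... | yes qx = (x , qx) ∷ restrict xs
  ... | no  _  = restrict xs

module _ (S : Setoid 0ℓ 0ℓ) {Q : Pred (Setoid.Carrier S) 0ℓ} (Q? : Decidable Q) where
  private
    module S = Setoid S
    T = On.setoid S (proj₁ {B = Q})
    module ∈S = Membership S
    module ∈T = Membership T
    module US = UniqueSetoid S
    module UT = UniqueSetoid T

  restrict-complete : (∀ {x y} → x S.≈ y → Q x → Q y) →
    ∀ z xs → proj₁ z ∈S.∈ xs → z ∈T.∈ restrict Q? xs
  restrict-complete resp (z , qz) (x ∷ xs) z∈ with Q? x | z∈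
  ... | yes _  | here z≈x  = here z≈x
  ... | yes _  | there z∈′ = there (restrict-complete resp (z , qz) xs z∈′)
  ... | no ¬qx | here z≈x  = contradiction (resp z≈x qz) ¬qx
  ... | no _   | there z∈′ = restrict-complete resp (z , qz) xs z∈′

  restrict-all : ∀ {W : Pred S.Carrier 0ℓ} xs → All W xs → All (W ∘ proj₁) (restrict Q? xs)
  restrict-all []       []       = []
  restrict-all (x ∷ xs) (w ∷ ws) with Q? x
  ... | yes _ = w ∷ restrict-all xs ws
  ... | no  _ = restrict-all xs ws

  restrict-unique : ∀ xs → US.Unique xs → UT.Unique (restrict Q? xs)
  restrict-unique []       []       = []
  restrict-unique (x ∷ xs) (p ∷ ps) with Q? x
  ... | yes _ = restrict-all xs p ∷ restrict-unique xs ps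
  ... | no  _ = restrict-unique xs ps

-- The sequence b₁ ≥ ⋯ ≥ b_r is b 1,…,b r; the values of b outside 1,…,r are
-- irrelevant.  Since bᵢ ≥ i, natural numbers suffice.
record Bounds (r : ℕ) (b : ℕ → ℕ) : Set where
  field
    nonempty   : 1 ≤ r
    decreasing : ∀ i → 1 ≤ i → i < r → b (suc i) ≤ b i
    diagonal   : ∀ i → 1 ≤ i → i ≤ r → i ≤ b i

Cell : Set
Cell = ℕ × ℕ

_⊑_ : Cell → Cell → Set
(i , c) ⊑ (j , d) = i ≥ j × c ≤ d

⊑-isDecPartialOrder : IsDecPartialOrder _≡_ _⊑_
⊑-isDecPartialOrder = record
  { isPartialOrder = record
    { isPreorder = record
      { isEquivalence = isEquivalence
      ; reflexive     = λ { refl → ℕ.≤-refl , ℕ.≤-refl }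
      ; trans         = λ (p , p′) (s , s′) → ℕ.≤-trans s p , ℕ.≤-trans p′ s′
      }
    ; antisym = λ (p , p′) (s , s′) → cong₂ _,_ (ℕ.≤-antisym s p) (ℕ.≤-antisym p′ s′)
    }
  ; _≟_  = ≡-dec ℕ._≟_ ℕ._≟_
  ; _≤?_ = λ (i , c) (j , d) → (j ≤? i) ×-dec (c ≤? d)
  }

⊑-decPoset : DecPoset 0ℓ 0ℓ 0ℓ
⊑-decPoset = record { isDecPartialOrder = ⊑-isDecPartialOrder }

cellRank : Cell → ℕ
cellRank (i , c) = c ∸ i

module Ferrers {r : ℕ} {b : ℕ → ℕ} (B : Bounds r b) where
  open Bounds B

  InFerrers : Cell → Set
  InFerrers (i , c) = (1 ≤ i × i ≤ r) × (i ≤ c × c ≤ b i)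

  inFerrers? : Decidable InFerrers
  inFerrers? (i , c) = ((1 ≤? i) ×-dec (i ≤? r)) ×-dec ((i ≤? c) ×-dec (c ≤? b i))

  FCell : Set
  FCell = Σ Cell InFerrers

  row col : FCell → ℕ
  row = proj₁ ∘ proj₁
  col = proj₂ ∘ proj₁

  private
    b≤b₁ : ∀ i → 1 ≤ i → i ≤ r → b i ≤ b 1
    b≤b₁ 1             _ _   = ℕ.≤-refl
    b≤b₁ (suc (suc i)) _ i≤r =
      ℕ.≤-trans (decreasing (suc i) (s≤s z≤n) i≤r) (b≤b₁ (suc i) (s≤s z≤n) (ℕ.<⇒≤ i≤r))

    F-decPoset : DecPoset 0ℓ 0ℓ 0ℓ
    F-decPoset = On.decPoset ⊑-decPoset (proj₁ {B = InFerrers})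

    module O = DecPoset F-decPoset

    grid : List Cell
    grid = cartesianProduct (upTo (suc r)) (upTo (suc (b 1)))

    rankF : FCell → ℕ
    rankF = cellRank ∘ proj₁

    minimal : ∀ x → (∀ z → z O.≤ x → z O.≈ x) → rankF x ≡ 0
    minimal ((i , c) , (1≤i , i≤r) , i≤c , c≤b) least with ℕ.m≤n⇒m<n∨m≡n i≤c
    ... | inj₂ refl = ℕ.n∸n≡0 c
    minimal ((i , suc c) , (1≤i , i≤r) , i≤c , c≤b) least | inj₁ (s≤s i≤c′)
      with () ← least ((i , c) , (1≤i , i≤r) , i≤c′ , ℕ.<⇒≤ c≤b) (ℕ.≤-refl , ℕ.n≤1+n c)

    cover : ∀ x y → x O.≤ y → ¬ x O.≈ y →
      (∀ z → x O.≤ z → z O.≤ y → z O.≈ x ⊎ z O.≈ y) → rankF y ≡ suc (rankF x)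
    cover ((i , c) , (1≤i , i≤r) , i≤c , c≤b) ((j , d) , (1≤j , j≤r) , j≤d , d≤b)
      (j≤i , c≤d) x≉y between with ℕ.m≤n⇒m<n∨m≡n j≤i
    cover ((suc i , c) , (1≤i , i≤r) , i≤c , c≤b) ((j , d) , (1≤j , j≤r) , j≤d , d≤b)
      (j≤i , c≤d) x≉y between | inj₁ (s≤s j≤i′)
      with between ((i , c) , (ℕ.≤-trans 1≤j j≤i′ , ℕ.<⇒≤ i≤r) , ℕ.<⇒≤ i≤c ,
                     ℕ.≤-trans c≤b (decreasing i (ℕ.≤-trans 1≤j j≤i′) i≤r))
                   (ℕ.n≤1+n i , ℕ.≤-refl) (j≤i′ , c≤d)
    ... | inj₂ refl = ℕ.+-∸-assoc 1 i≤c
    cover ((i , c) , (1≤i , i≤r) , i≤c , c≤b) ((j , d) , (1≤j , j≤r) , j≤d , d≤b)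
      (j≤i , c≤d) x≉y between | inj₂ refl with ℕ.m≤n⇒m<n∨m≡n c≤d
    ... | inj₂ refl = contradiction refl x≉y
    ... | inj₁ c<d with between ((i , suc c) , (1≤i , i≤r) , ℕ.m≤n⇒m≤1+n i≤c ,
                                  ℕ.≤-trans c<d d≤b)
                                (ℕ.≤-refl , ℕ.n≤1+n c) (ℕ.≤-refl , c<d)
    ... | inj₂ refl = ℕ.+-∸-assoc 1 i≤c

  F : GradedPoset
  F = record
    { decPoset          = F-decPoset
    ; elements          = restrict inFerrers? grid
    ; elements-complete = λ { x@((i , c) , (1≤i , i≤r) , _ , c≤b) →
        restrict-complete ⊑.setoid inFerrers? (λ { refl p → p }) x grid
          (∈-cartesianProduct⁺ (∈-upTo⁺ (s≤s i≤r))
            (∈-upTo⁺ (s≤s (ℕ.≤-trans c≤b (b≤b₁ i 1≤i i≤r))))) }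
    ; elements-unique   = restrict-unique ⊑.setoid inFerrers? grid
        (Unique.cartesianProduct⁺ (Unique.upTo⁺ (suc r)) (Unique.upTo⁺ (suc (b 1))))
    ; top               = (1 , b 1) , (ℕ.≤-refl , nonempty) ,
                          diagonal 1 ℕ.≤-refl nonempty , ℕ.≤-refl
    ; top-maximum       = λ { ((i , c) , (1≤i , i≤r) , _ , c≤b) →
        1≤i , ℕ.≤-trans c≤b (b≤b₁ i 1≤i i≤r) }
    ; rank              = rankF
    ; rank-minimal      = minimal
    ; rank-cover        = λ x y ((x≤y , x≉y) , between) → cover x y x≤y x≉y between
    }
    where module ⊑ = DecPoset.Eq ⊑-decPoset

  open GradedPoset F public using () renaming (_≼_ to infix 4 _≤F_; _≺_ to infix 4 _<F_)

  private
    rank-monotone : ∀ x y → x ≤F y → rankF x ≤ rankF y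
    rank-monotone _ _ (j≤i , c≤d) = ℕ.∸-mono c≤d j≤i

  -- The interval [x,y], ranked by ρ(z) - ρ(x).
  interval : ∀ x y → x ≤F y → GradedPoset
  interval x y x≤y = record
    { decPoset          = On.decPoset F-decPoset (proj₁ {B = Between})
    ; elements          = restrict between? F.elements
    ; elements-complete = λ z →
        restrict-complete FEq.setoid between?
          (λ z≈w (x≤z , z≤y) → subst (λ s → proj₁ x ⊑ s) z≈w x≤z ,
                               subst (λ s → s ⊑ proj₁ y) z≈w z≤y)
          z F.elements (F.elements-complete (proj₁ z))
    ; elements-unique   = restrict-unique FEq.setoid between? F.elements F.elements-unique
    ; top               = y , x≤y , ≤-refl {y}
    ; top-maximum       = λ (_ , _ , z≤y) → z≤y
    ; rank              = λ (z , _) → rankF z ∸ rankF x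
    ; rank-minimal      = λ (z , x≤z , _) least →
        trans (cong (λ s → cellRank s ∸ rankF x) (sym (least (x , ≤-refl {x} , x≤y) x≤z)))
              (ℕ.n∸n≡0 (rankF x))
    ; rank-cover        = λ (z , x≤z , z≤y) (w , x≤w , w≤y) ((z≤w , z≉w) , between) →
        trans (cong (_∸ rankF x)
                 (cover z w z≤w z≉w λ v z≤v v≤w →
                   between (v , ≤-trans {x} {z} {v} x≤z z≤v , ≤-trans {v} {w} {y} v≤w w≤y)
                           z≤v v≤w))
              (ℕ.+-∸-assoc 1 (rank-monotone x z x≤z))
    }
    where
    module F = GradedPoset F
    module FEq = DecPoset.Eq F-decPoset
    ≤-refl : ∀ {z} → z ≤F z
    ≤-refl = ℕ.≤-refl , ℕ.≤-refl
    ≤-trans : ∀ {u v w} → u ≤F v → v ≤F w → u ≤F w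
    ≤-trans (p , p′) (s , s′) = ℕ.≤-trans s p , ℕ.≤-trans p′ s′
    Between : FCell → Set
    Between z = x ≤F z × z ≤F y
    between? : Decidable Between
    between? z = (x F.≼? z) ×-dec (z F.≼? y)

data Letter : Set where
  L R : Letter

_≟ˡ_ : DecidableEquality Letter
L ≟ˡ L = yes refl
L ≟ˡ R = no λ ()
R ≟ˡ L = no λ ()
R ≟ˡ R = yes refl

#_ : Letter → ∀ {n} → Vec Letter n → ℕ
(# a) w = length (filter (a ≟ˡ_) (toList w))

-- Number of letters a among the first k letters.
#prefix : Letter → ℕ → ∀ {n} → Vec Letter n → ℕ
#prefix a k w = length (filter (a ≟ˡ_) (List.take k (toList w)))

-- Every prefix of w satisfies  c + R_k ≤ b_{i - L_k}.  Whenever this is used,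
-- w has fewer than i letters L, so the subtraction does not truncate.
StaysInside : (b : ℕ → ℕ) (i c : ℕ) → ∀ {n} → Vec Letter n → Set
StaysInside b i c {n} w =
  ∀ (k : Fin (suc n)) → c + #prefix R (toℕ k) w ≤ b (i ∸ #prefix L (toℕ k) w)

staysInside? : ∀ b i c {n} (w : Vec Letter n) → Dec (StaysInside b i c w)
staysInside? b i c w = all? λ k → _ ≤? _

-- The k-th letter of w, counted from 1, exists and is a.
_at_is_ : ∀ {n} → Vec Letter n → ℕ → Letter → Set
w at k is a = ∃ λ i → suc (toℕ i) ≡ k × lookup w i ≡ a

_at_is?_ : ∀ {n} (w : Vec Letter n) k a → Dec (w at k is a)
w at k is? a = any? λ i → (suc (toℕ i) ℕ.≟ k) ×-dec (lookup w i ≟ˡ a)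

words : ∀ n → List (Vec Letter n)
words = tuples (L ∷ R ∷ [])

-- The variables u₁,…,uₙ and positions 1,…,n are indexed by Fin n.
pos : ∀ {n} → Fin n → ℕ
pos j = suc (toℕ j)

module Global (r : ℕ) (b : ℕ → ℕ) where

  M : ℕ
  M = b 1 ∸ 1

  ι : Vec Letter M → ℕ
  ι w = (# L) w + 1

  IsGlobalWord : Vec Letter M → Set
  IsGlobalWord w = (# L) w ≤ r ∸ 1 × StaysInside b (ι w) (ι w) w

  isGlobalWord? : Decidable IsGlobalWord
  isGlobalWord? w = ((# L) w ≤? r ∸ 1) ×-dec staysInside? b (ι w) (ι w) w

  𝒲 : List (Vec Letter M)
  𝒲 = filter isGlobalWord? (words M)

  Descent : Vec Letter M → Fin M → Set
  Descent w j = w at pos j is L × (pos j ≡ 1 ⊎ w at (pos j ∸ 1) is R)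

  descent? : ∀ w → Decidable (Descent w)
  descent? w j = (w at pos j is? L) ×-dec ((pos j ℕ.≟ 1) ⊎-dec (w at (pos j ∸ 1) is? R))

  D : Vec Letter M → List (Fin M)
  D w = filter (descent? w) (allFin M)

  𝒟 : Poly M
  𝒟 = ∑[ w ∈ 𝒲 ] ∏[ j ∈ D w ] var j
    where open RingOps (polyRing M)

  -- 𝒟(t, tq, …, tqᴹ⁻¹); the exponent of q at position j is j - 1.
  𝒟-specialized : Poly 2
  𝒟-specialized = eval ℤ[q,t] 𝒟 λ j → t ⊗ q ^ (pos j ∸ 1)
    where open RingOps ℤ[q,t]

-- Used for x = (i , c) ≤ y = (j , d), where the subtractions are exact.
module Local (b : ℕ → ℕ) (i c j d : ℕ) where

  h : ℕ
  h = (i ∸ j) + (d ∸ c)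

  IsLocalWord : Vec Letter h → Set
  IsLocalWord w = ((# L) w ≡ i ∸ j × (# R) w ≡ d ∸ c) × StaysInside b i c w

  isLocalWord? : Decidable IsLocalWord
  isLocalWord? w =
    (((# L) w ℕ.≟ i ∸ j) ×-dec ((# R) w ℕ.≟ d ∸ c)) ×-dec staysInside? b i c w

  𝒲 : List (Vec Letter h)
  𝒲 = filter isLocalWord? (words h)

  Descent : Vec Letter h → Fin (h ∸ 1) → Set
  Descent w p = w at pos p is R × w at suc (pos p) is L

  descent? : ∀ w → Decidable (Descent w)
  descent? w p = (w at pos p is? R) ×-dec (w at suc (pos p) is? L)

  D : Vec Letter h → List (Fin (h ∸ 1))
  D w = filter (descent? w) (allFin (h ∸ 1))

  𝒟 : Poly (h ∸ 1)
  𝒟 = ∑[ w ∈ 𝒲 ] ∏[ p ∈ D w ] var p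
    where open RingOps (polyRing (h ∸ 1))

  -- 𝒟(tq, tq², …, tqʰ⁻¹); the exponent of q at position p is p.
  𝒟-specialized : Poly 2
  𝒟-specialized = eval ℤ[q,t] 𝒟 λ p → t ⊗ q ^ pos p
    where open RingOps ℤ[q,t]

{-# OPTIONS --safe #-}
-- Let Z(i,c) count the weak chains above a cell (i,c) and E(i,c) those whose least cell lies
-- in row i at or beyond column c, by length (t) and rank sum (q).  With ρ the rank of (i,c),
--   Z(i,c) = Z(i-1,c) + E(i,c)   and   E(i,c) = q^ρ t Z(i,c) + E(i,c+1).
-- Let W(i,c) and W'(i,c) sum the descent weights of the lattice paths from (i,c) to the top
-- cell that are preceded by an L or by an R, respectively.  Splitting off the first letter,
--   W(i,c) = W(i-1,c) + W'(i,c+1)   and   W'(i,c) = q^ρ t W(i-1,c) + W'(i,c+1).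
-- In the top row the terms from row i-1 are absent and the empty chain counts in E.  Hence
-- W and W' are Z and E multiplied by ∏ (1 - qᵃt) over the ranks a ≥ ρ.  An interval [x,y] is
-- the case of Z(x); the chains of F are split by the row of their least cell into the E(i,i).
module Submission where

open import Defs
open import Algebra.Bundles.Raw using (RawRing)
open import Data.Bool.Base using (Bool; true; false; if_then_else_; _∧_)
open import Data.Fin.Base using (Fin; zero; suc; toℕ; inject₁)
open import Data.Fin.Properties using (toℕ-injective; toℕ-inject₁)
open import Data.Integer.Base as ℤ using (ℤ; +_; -[1+_]; -_)
  renaming (_+_ to infixl 6 _⊕_; _*_ to infixl 7 _⊗_)
import Data.Integer.Properties as ℤ
open import Data.Integer.Tactic.RingSolver using (solve-∀)
open import Data.List.Base as List
  using (List; []; _∷_; _++_; foldr; filter; upTo; applyUpTo; allFin; tabulate; cartesianProductWith)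
open import Data.List.Extrema.Nat using (max≤v⁺; v≤max⁺)
open import Data.List.Membership.Propositional using (_∈_)
open import Data.List.Membership.Propositional.Properties using (∈-map⁻)
open import Data.List.Properties using (map-upTo)
open import Data.List.Relation.Unary.All as All using ([]; _∷_)
import Data.List.Relation.Unary.All.Properties as All
open import Data.List.Relation.Unary.AllPairs as AllPairs using ([]; _∷_)
import Data.List.Relation.Unary.AllPairs.Properties as AllPairs
open import Data.List.Relation.Unary.Any as Any using (here; there)
import Data.List.Relation.Unary.Any.Properties as Any
open import Data.List.Relation.Unary.Unique.Propositional using (Unique)
open import Data.Nat.Base using (ℕ; zero; suc; _+_; _*_; _∸_; _≤_; _<_; z≤n; s≤s; _≡ᵇ_)
open import Data.Nat.Properties as ℕ using (_≟_; _≤?_)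
import Data.Nat.Tactic.RingSolver as ℕ
open import Data.Product.Base using (∃; _×_; _,_; proj₁; proj₂; swap)
open import Data.Product.Function.NonDependent.Propositional using (_×-⇔_)
open import Data.Product.Properties using (≡-dec)
open import Data.Sum.Base using (_⊎_; inj₁; inj₂)
open import Data.Unit.Base using (⊤; tt)
open import Data.Vec.Base as Vec using (Vec; []; _∷_; lookup)
import Data.Vec.Properties as Vec
open import Data.Vec.Relation.Unary.Linked using (Linked; linked?; []; [-]; _∷_)
open import Function.Base using (_∘_; id)
open import Function.Bundles using (_⇔_; mk⇔; Equivalence)
open import Function.Construct.Composition using (_⇔-∘_)
open import Level using (0ℓ)
open import Relation.Binary.PropositionalEquality
open import Relation.Nullary.Decidable using (Dec; yes; no; does; _×-dec_; does-⇔; dec-true; dec-false)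
open import Relation.Nullary.Negation using (¬_; contradiction)
open import Relation.Unary using (Pred; Decidable)

open ≡-Reasoning

open RingOps ℤ.+-*-rawRing using (∑)

-- The two descent conventions come from the two ways a poset can begin. An interval has a least
-- cell `x`, all its chains are counted by Z(x), and a path counted by W has no descent at its first
-- letter. The diagonal cells (i,i) of F are pairwise incomparable minimal cells, so the chains of F
-- form a sum of E(i,i), and a path counted by W' does have a descent at an initial L. One product
-- clears both series because every letter raises the rank by one. With rank a and n letters to go,
-- the ranks are a, ..., a+n, and both cells reachable in one step need the same product from a+1
-- on. For Z, substituting the recursion of E leaves (1 - qᵃt) Z(i,c) = Z(i-1,c) + E(i,c+1). For E,
-- the cleared forms x of Z(i-1,c) and y of E(i,c+1) enter as qᵃt (x + y) + (1 - qᵃt) y = qᵃt x + y;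
-- this cancellation is what creates the descent weight. The obstacle is that (i,c+1) can lie off
-- the shape. Hence the series and the path sums are defined for arbitrary cells, and below the top
-- row both sides vanish there.

private variable
  X Y V : Set
  n : ℕ

-- Indicator terms and finite sums of integers

when : Bool → ℤ → ℤ
when b x = if b then x else + 0

when-0 : ∀ b → when b (+ 0) ≡ + 0
when-0 true  = refl
when-0 false = refl

when-∧ : ∀ a b x → when (a ∧ b) x ≡ when a (when b x)
when-∧ true  b x = refl
when-∧ false b x = refl

-- Each case split of the counting argument is an instance: chains by the row of their least cell,
-- row chains by whether they begin at the given cell, and global words by their number of letters
-- `L`.
when-⊎ : {P Q R : Set} (P? : Dec P) (Q? : Dec Q) (R? : Dec R) →
  (P → Q ⊎ R) → (Q → P) → (R → P) → ¬ (Q × R) → ∀ x →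
  when (does P?) x ≡ when (does Q?) x ⊕ when (does R?) x
when-⊎ (yes p) (yes q) (yes r) f g h e x = contradiction (q , r) e
when-⊎ (yes p) (yes q) (no ¬r) f g h e x = sym (ℤ.+-identityʳ x)
when-⊎ (yes p) (no ¬q) (yes r) f g h e x = sym (ℤ.+-identityˡ x)
when-⊎ (yes p) (no ¬q) (no ¬r) f g h e x with f p
... | inj₁ q = contradiction q ¬q
... | inj₂ r = contradiction r ¬r
when-⊎ (no ¬p) (yes q) _       f g h e x = contradiction (g q) ¬p
when-⊎ (no ¬p) (no ¬q) (yes r) f g h e x = contradiction (h r) ¬p
when-⊎ (no ¬p) (no ¬q) (no ¬r) f g h e x = refl

∑-cong-∈ : (xs : List X) {f g : X → ℤ} → (∀ x → x ∈ xs → f x ≡ g x) → ∑ xs f ≡ ∑ xs g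
∑-cong-∈ []       e = refl
∑-cong-∈ (x ∷ xs) e = cong₂ _⊕_ (e x (here refl)) (∑-cong-∈ xs λ y → e y ∘ there)

∑-cong : (xs : List X) {f g : X → ℤ} → (∀ x → f x ≡ g x) → ∑ xs f ≡ ∑ xs g
∑-cong xs e = ∑-cong-∈ xs λ x _ → e x

∑-0 : (xs : List X) → ∑ xs (λ _ → + 0) ≡ + 0
∑-0 []       = refl
∑-0 (x ∷ xs) = trans (ℤ.+-identityˡ _) (∑-0 xs)

∑-⊕ : (xs : List X) (f g : X → ℤ) → ∑ xs (λ x → f x ⊕ g x) ≡ ∑ xs f ⊕ ∑ xs g
∑-⊕ []       f g = refl
∑-⊕ (x ∷ xs) f g =
  trans (cong (f x ⊕ g x ⊕_) (∑-⊕ xs f g)) (interchange (f x) (g x) (∑ xs f) (∑ xs g))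
  where
  interchange : ∀ a b c d → a ⊕ b ⊕ (c ⊕ d) ≡ a ⊕ c ⊕ (b ⊕ d)
  interchange = solve-∀

∑-++ : (xs ys : List X) (f : X → ℤ) → ∑ (xs ++ ys) f ≡ ∑ xs f ⊕ ∑ ys f
∑-++ []       ys f = sym (ℤ.+-identityˡ _)
∑-++ (x ∷ xs) ys f = trans (cong (f x ⊕_) (∑-++ xs ys f)) (sym (ℤ.+-assoc (f x) _ _))

∑-map : (g : X → Y) (xs : List X) (f : Y → ℤ) → ∑ (List.map g xs) f ≡ ∑ xs (f ∘ g)
∑-map g []       f = refl
∑-map g (x ∷ xs) f = cong (f (g x) ⊕_) (∑-map g xs f)

∑-when : (xs : List X) (b : Bool) (f : X → ℤ) → ∑ xs (λ x → when b (f x)) ≡ when b (∑ xs f)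
∑-when xs true  f = refl
∑-when xs false f = ∑-0 xs

∑-filter : {P : Pred X 0ℓ} (P? : Decidable P) (xs : List X) (f : X → ℤ) →
  ∑ (filter P? xs) f ≡ ∑ xs (λ x → when (does (P? x)) (f x))
∑-filter P? []       f = refl
∑-filter P? (x ∷ xs) f with does (P? x)
... | true  = cong (f x ⊕_) (∑-filter P? xs f)
... | false = trans (∑-filter P? xs f) (sym (ℤ.+-identityˡ _))

∑-cartesianProductWith : (h : X → Y → V) (xs : List X) (ys : List Y) (f : V → ℤ) →
  ∑ (cartesianProductWith h xs ys) f ≡ ∑ xs (λ x → ∑ ys (λ y → f (h x y)))
∑-cartesianProductWith h []       ys f = refl
∑-cartesianProductWith h (x ∷ xs) ys f =
  trans (∑-++ (List.map (h x) ys) _ f)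
    (cong₂ _⊕_ (∑-map (h x) ys f) (∑-cartesianProductWith h xs ys f))

∑-delta : (_≟ˣ_ : (x y : X) → Dec (x ≡ y)) {xs : List X} → Unique xs → (f : X → ℤ) →
  ∀ {x} → x ∈ xs → ∑ xs (λ y → when (does (y ≟ˣ x)) (f y)) ≡ f x
∑-delta _≟ˣ_ {xs = x ∷ xs} (x∉ ∷ _) f (here refl) = begin
  when (does (x ≟ˣ x)) (f x) ⊕ _
    ≡⟨ cong₂ (λ b s → when b (f x) ⊕ s) (dec-true (x ≟ˣ x) refl)
         (trans (∑-cong-∈ xs λ y y∈ →
                   cong (λ b → when b (f y))
                        (dec-false (y ≟ˣ x) λ y≡x → All.lookup x∉ y∈ (sym y≡x)))
                (∑-0 xs)) ⟩
  f x ⊕ + 0  ≡⟨ ℤ.+-identityʳ _ ⟩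
  f x        ∎
∑-delta _≟ˣ_ {xs = y ∷ xs} (y∉ ∷ u) f {x} (there x∈) =
  trans (cong₂ _⊕_ (cong (λ b → when b (f y)) (dec-false (y ≟ˣ x) (All.lookup y∉ x∈)))
                   (∑-delta _≟ˣ_ u f x∈))
        (ℤ.+-identityˡ _)

-- Formal power series in q and t

Series : Set
Series = RawRing.Carrier ℤ⟦q⟧⟦t⟧

infix  4 _≐_
infixl 6 _⊞_

_≐_ : Series → Series → Set
f ≐ g = ∀ m k → f m k ≡ g m k

_⊞_ : Series → Series → Series
(f ⊞ g) m k = f m k ⊕ g m k

𝟘 δ : Series
𝟘 m k = + 0
δ zero    zero    = + 1
δ zero    (suc k) = + 0
δ (suc m) k       = + 0

-- Multiplication by qᵃ on ℤ⟦q⟧.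
shift : ℕ → (ℕ → ℤ) → ℕ → ℤ
shift zero    f k       = f k
shift (suc a) f zero    = + 0
shift (suc a) f (suc k) = shift a f k

-- Multiplications are kept as operators, so that the recursions need only linearity and
-- commutation; `*₂-∏-factor` later identifies them with the Cauchy product.
mul-qᵃt mul-1-qᵃt : ℕ → Series → Series
mul-qᵃt a f zero    k = + 0
mul-qᵃt a f (suc m) k = shift a (f m) k
mul-1-qᵃt a f m k = f m k ⊕ - mul-qᵃt a f m k

-- Multiplication by (1 - qᵃt)(1 - qᵃ⁺¹t)⋯(1 - qᵃ⁺ⁿt).
mul-∏ : ℕ → ℕ → Series → Series
mul-∏ zero    a f = mul-1-qᵃt a f
mul-∏ (suc n) a f = mul-1-qᵃt a (mul-∏ n (suc a) f)

shift-cong : ∀ a {f g : ℕ → ℤ} → (∀ k → f k ≡ g k) → ∀ k → shift a f k ≡ shift a g k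
shift-cong zero    e k       = e k
shift-cong (suc a) e zero    = refl
shift-cong (suc a) e (suc k) = shift-cong a e k

shift-0 : ∀ a k → shift a (λ _ → + 0) k ≡ + 0
shift-0 zero    k       = refl
shift-0 (suc a) zero    = refl
shift-0 (suc a) (suc k) = shift-0 a k

shift-⊕ : ∀ a (f g : ℕ → ℤ) k → shift a (λ k → f k ⊕ g k) k ≡ shift a f k ⊕ shift a g k
shift-⊕ zero    f g k       = refl
shift-⊕ (suc a) f g zero    = refl
shift-⊕ (suc a) f g (suc k) = shift-⊕ a f g k

shift-neg : ∀ a (f : ℕ → ℤ) k → shift a (λ k → - f k) k ≡ - shift a f k
shift-neg zero    f k       = refl
shift-neg (suc a) f zero    = refl
shift-neg (suc a) f (suc k) = shift-neg a f k

shift-∑ : ∀ a (xs : List X) (f : X → ℕ → ℤ) k →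
  shift a (λ k → ∑ xs (λ x → f x k)) k ≡ ∑ xs (λ x → shift a (f x) k)
shift-∑ a []       f k = shift-0 a k
shift-∑ a (x ∷ xs) f k =
  trans (shift-⊕ a (f x) _ k) (cong (shift a (f x) k ⊕_) (shift-∑ a xs f k))

shift-when : ∀ a b (f : ℕ → ℤ) k → shift a (λ k → when b (f k)) k ≡ when b (shift a f k)
shift-when a true  f k = refl
shift-when a false f k = shift-0 a k

-- `shift` recurses from the outside. Peeling one step from the inside reduces commutation with
-- another shift, and with the Cauchy product, to the case of `shift 1`.
shift-suc : ∀ a (f : ℕ → ℤ) k → shift (suc a) f k ≡ shift a (shift 1 f) k
shift-suc zero    f zero    = refl
shift-suc zero    f (suc k) = refl
shift-suc (suc a) f zero    = refl
shift-suc (suc a) f (suc k) = shift-suc a f k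

shift-comm : ∀ a b (f : ℕ → ℤ) k → shift a (shift b f) k ≡ shift b (shift a f) k
shift-comm zero    b f k = refl
shift-comm (suc a) b f k = begin
  shift (suc a) (shift b f) k        ≡⟨ shift-suc a (shift b f) k ⟩
  shift a (shift 1 (shift b f)) k    ≡⟨ shift-cong a (one b f) k ⟩
  shift a (shift b (shift 1 f)) k    ≡⟨ shift-comm a b (shift 1 f) k ⟩
  shift b (shift a (shift 1 f)) k    ≡⟨ shift-cong b (λ k → sym (shift-suc a f k)) k ⟩
  shift b (shift (suc a) f) k        ∎
  where
  one : ∀ b (f : ℕ → ℤ) k → shift 1 (shift b f) k ≡ shift b (shift 1 f) k
  one zero    f k             = refl
  one (suc b) f zero          = refl
  one (suc b) f (suc zero)    = sym (shift-1-0 b)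
    where
    shift-1-0 : ∀ b → shift b (shift 1 f) 0 ≡ + 0
    shift-1-0 zero    = refl
    shift-1-0 (suc b) = refl
  one (suc b) f (suc (suc k)) = one b f (suc k)

mul-qᵃt-cong : ∀ a {f g} → f ≐ g → mul-qᵃt a f ≐ mul-qᵃt a g
mul-qᵃt-cong a e zero    k = refl
mul-qᵃt-cong a e (suc m) k = shift-cong a (e m) k

mul-qᵃt-⊞ : ∀ a f g → mul-qᵃt a (f ⊞ g) ≐ mul-qᵃt a f ⊞ mul-qᵃt a g
mul-qᵃt-⊞ a f g zero    k = refl
mul-qᵃt-⊞ a f g (suc m) k = shift-⊕ a (f m) (g m) k

mul-qᵃt-comm : ∀ a b f → mul-qᵃt a (mul-qᵃt b f) ≐ mul-qᵃt b (mul-qᵃt a f)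
mul-qᵃt-comm a b f zero          k = refl
mul-qᵃt-comm a b f (suc zero)    k = trans (shift-0 a k) (sym (shift-0 b k))
mul-qᵃt-comm a b f (suc (suc m)) k = shift-comm a b (f m) k

mul-1-qᵃt-cong : ∀ a {f g} → f ≐ g → mul-1-qᵃt a f ≐ mul-1-qᵃt a g
mul-1-qᵃt-cong a e m k = cong₂ (λ x y → x ⊕ - y) (e m k) (mul-qᵃt-cong a e m k)

mul-1-qᵃt-⊞ : ∀ a f g → mul-1-qᵃt a (f ⊞ g) ≐ mul-1-qᵃt a f ⊞ mul-1-qᵃt a g
mul-1-qᵃt-⊞ a f g m k =
  trans (cong (λ x → f m k ⊕ g m k ⊕ - x) (mul-qᵃt-⊞ a f g m k))
        (rearrange (f m k) (g m k) (mul-qᵃt a f m k) (mul-qᵃt a g m k))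
  where
  rearrange : ∀ x y u v → x ⊕ y ⊕ - (u ⊕ v) ≡ x ⊕ - u ⊕ (y ⊕ - v)
  rearrange = solve-∀

mul-1-qᵃt-mul-qᵃt : ∀ a b f → mul-1-qᵃt a (mul-qᵃt b f) ≐ mul-qᵃt b (mul-1-qᵃt a f)
mul-1-qᵃt-mul-qᵃt a b f zero    k = refl
mul-1-qᵃt-mul-qᵃt a b f (suc m) k = begin
  shift b (f m) k ⊕ - mul-qᵃt a (mul-qᵃt b f) (suc m) k
    ≡⟨ cong (λ x → shift b (f m) k ⊕ - x) (mul-qᵃt-comm a b f (suc m) k) ⟩
  shift b (f m) k ⊕ - shift b (mul-qᵃt a f m) k
    ≡⟨ cong (shift b (f m) k ⊕_) (shift-neg b (mul-qᵃt a f m) k) ⟨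
  shift b (f m) k ⊕ shift b (λ k → - mul-qᵃt a f m k) k
    ≡⟨ shift-⊕ b (f m) _ k ⟨
  shift b (mul-1-qᵃt a f m) k ∎

mul-1-qᵃt-comm : ∀ a b f → mul-1-qᵃt a (mul-1-qᵃt b f) ≐ mul-1-qᵃt b (mul-1-qᵃt a f)
mul-1-qᵃt-comm a b f m k = begin
  mul-1-qᵃt b f m k ⊕ - mul-qᵃt a (mul-1-qᵃt b f) m k
    ≡⟨ cong (λ x → mul-1-qᵃt b f m k ⊕ - x) (mul-1-qᵃt-mul-qᵃt b a f m k) ⟨
  mul-1-qᵃt b f m k ⊕ - mul-1-qᵃt b (mul-qᵃt a f) m k
    ≡⟨ rearrange (f m k) (mul-qᵃt b f m k) (mul-qᵃt a f m k) (mul-qᵃt b (mul-qᵃt a f) m k) ⟩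
  mul-1-qᵃt a f m k ⊕ - (mul-qᵃt b f m k ⊕ - mul-qᵃt b (mul-qᵃt a f) m k)
    ≡⟨ cong (λ x → mul-1-qᵃt a f m k ⊕ - (mul-qᵃt b f m k ⊕ - x)) (mul-qᵃt-comm b a f m k) ⟩
  mul-1-qᵃt a f m k ⊕ - mul-1-qᵃt a (mul-qᵃt b f) m k
    ≡⟨ cong (λ x → mul-1-qᵃt a f m k ⊕ - x) (mul-1-qᵃt-mul-qᵃt a b f m k) ⟩
  mul-1-qᵃt a f m k ⊕ - mul-qᵃt b (mul-1-qᵃt a f) m k ∎
  where
  rearrange : ∀ x y u v → x ⊕ - y ⊕ - (u ⊕ - v) ≡ x ⊕ - u ⊕ - (y ⊕ - v)
  rearrange = solve-∀

mul-∏-cong : ∀ n a {f g} → f ≐ g → mul-∏ n a f ≐ mul-∏ n a g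
mul-∏-cong zero    a e = mul-1-qᵃt-cong a e
mul-∏-cong (suc n) a e = mul-1-qᵃt-cong a (mul-∏-cong n (suc a) e)

mul-∏-⊞ : ∀ n a f g → mul-∏ n a (f ⊞ g) ≐ mul-∏ n a f ⊞ mul-∏ n a g
mul-∏-⊞ zero    a f g m k = mul-1-qᵃt-⊞ a f g m k
mul-∏-⊞ (suc n) a f g m k =
  trans (mul-1-qᵃt-cong a (mul-∏-⊞ n (suc a) f g) m k)
        (mul-1-qᵃt-⊞ a (mul-∏ n (suc a) f) (mul-∏ n (suc a) g) m k)

mul-∏-mul-qᵃt : ∀ n a b f → mul-∏ n a (mul-qᵃt b f) ≐ mul-qᵃt b (mul-∏ n a f)
mul-∏-mul-qᵃt zero    a b f m k = mul-1-qᵃt-mul-qᵃt a b f m k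
mul-∏-mul-qᵃt (suc n) a b f m k =
  trans (mul-1-qᵃt-cong a (mul-∏-mul-qᵃt n (suc a) b f) m k)
        (mul-1-qᵃt-mul-qᵃt a b (mul-∏ n (suc a) f) m k)

-- Lets the outermost factor of a product move inwards, to act directly on a series whose recursion
-- it resolves.
mul-∏-mul-1-qᵃt : ∀ n a b f → mul-∏ n a (mul-1-qᵃt b f) ≐ mul-1-qᵃt b (mul-∏ n a f)
mul-∏-mul-1-qᵃt zero    a b f m k = mul-1-qᵃt-comm a b f m k
mul-∏-mul-1-qᵃt (suc n) a b f m k =
  trans (mul-1-qᵃt-cong a (mul-∏-mul-1-qᵃt n (suc a) b f) m k)
        (mul-1-qᵃt-comm a b (mul-∏ n (suc a) f) m k)

mul-1-qᵃt-𝟘 : ∀ a → mul-1-qᵃt a 𝟘 ≐ 𝟘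
mul-1-qᵃt-𝟘 a zero    k = refl
mul-1-qᵃt-𝟘 a (suc m) k = cong (λ x → + 0 ⊕ - x) (shift-0 a k)

mul-∏-𝟘 : ∀ n a → mul-∏ n a 𝟘 ≐ 𝟘
mul-∏-𝟘 zero    a = mul-1-qᵃt-𝟘 a
mul-∏-𝟘 (suc n) a m k =
  trans (mul-1-qᵃt-cong a (mul-∏-𝟘 n (suc a)) m k) (mul-1-qᵃt-𝟘 a m k)

-- Descent weights and sums over lattice paths

∑-words : ∀ n (f : Vec Letter (suc n) → ℤ) →
  ∑ (words (suc n)) f ≡ ∑ (words n) (f ∘ (L ∷_)) ⊕ ∑ (words n) (f ∘ (R ∷_))
∑-words n f =
  trans (∑-cartesianProductWith _∷_ (L ∷ R ∷ []) (words n) f)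
        (cong (∑ (words n) (f ∘ (L ∷_)) ⊕_) (ℤ.+-identityʳ _))

mul-qᵃt-if : Bool → ℕ → Series → Series
mul-qᵃt-if true  a f = mul-qᵃt a f
mul-qᵃt-if false a f = f

-- The flag tells whether w is preceded by R (or, for global words, whether w starts the
-- word: its first letter is then a descent if it is L); the first position counts as qᵃt.
weight : Bool → ℕ → Vec Letter n → Series
weight f a []      = δ
weight f a (L ∷ w) = mul-qᵃt-if f a (weight false (suc a) w)
weight f a (R ∷ w) = weight true (suc a) w

mul-qᵃt-if-∑ : ∀ f a (xs : List X) (p : X → Bool) (g : X → Series) →
  (λ m k → ∑ xs (λ x → when (p x) (mul-qᵃt-if f a (g x) m k)))
    ≐ mul-qᵃt-if f a (λ m k → ∑ xs (λ x → when (p x) (g x m k)))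
mul-qᵃt-if-∑ false a xs p g m       k = refl
mul-qᵃt-if-∑ true  a xs p g zero    k =
  trans (∑-cong xs λ x → when-0 (p x)) (∑-0 xs)
mul-qᵃt-if-∑ true  a xs p g (suc m) k =
  trans (∑-cong xs λ x → sym (shift-when a (p x) (g x m) k))
        (sym (shift-∑ a xs (λ x k → when (p x) (g x m k)) k))

module Paths (b : ℕ → ℕ) (j d : ℕ) where

  -- The letter counts are in additive form, so that removing a letter never meets a truncated
  -- subtraction.
  Path : ℕ → ℕ → Vec Letter n → Set
  Path i c w = ((# L) w + j ≡ i × (# R) w + c ≡ d) × StaysInside b i c w

  path? : ∀ i c (w : Vec Letter n) → Dec (Path i c w)
  path? i c w = (((# L) w + j ≟ i) ×-dec ((# R) w + c ≟ d)) ×-dec staysInside? b i c w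

  path-inside : ∀ {i c} {w : Vec Letter n} → Path i c w → c ≤ d × c ≤ b i
  path-inside {i = i} {c} {w} ((_ , eq) , s) =
    subst (c ≤_) eq (ℕ.m≤n+m c _) , subst (_≤ b i) (ℕ.+-identityʳ c) (s zero)

  -- No bound on `c` is assumed, because the empty prefix of the remainder already gives
  -- `suc c ≤ b i`. After an `L` the remainder only bounds `c` in the next, possibly longer row, so
  -- `path-L` must assume `c ≤ b (suc i)`.
  path-R : ∀ {i c} {w : Vec Letter n} → Path i c (R ∷ w) ⇔ Path i (suc c) w
  path-R {i = i} {c} {w} = mk⇔
    (λ ((l , r) , s) → (l , trans (ℕ.+-suc _ c) r) ,
       λ k → subst (_≤ b (i ∸ #prefix L (toℕ k) w)) (ℕ.+-suc c _) (s (suc k)))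
    (λ p@((l , r) , s) → (l , trans (sym (ℕ.+-suc _ c)) r) , λ
       { zero    → subst (_≤ b i) (sym (ℕ.+-identityʳ c))
                     (ℕ.≤-trans (ℕ.n≤1+n c) (proj₂ (path-inside {w = w} p)))
       ; (suc k) → subst (_≤ b (i ∸ #prefix L (toℕ k) w)) (sym (ℕ.+-suc c _)) (s k) })

  path-L : ∀ {i c} {w : Vec Letter n} → c ≤ b (suc i) → Path (suc i) c (L ∷ w) ⇔ Path i c w
  path-L {i = i} {c} {w} c≤b = mk⇔
    (λ ((l , r) , s) → (ℕ.suc-injective l , r) , λ k → s (suc k))
    (λ ((l , r) , s) → (cong suc l , r) , λ
       { zero    → subst (_≤ b (suc i)) (sym (ℕ.+-identityʳ c)) c≤b
       ; (suc k) → s k })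

  ¬path-L : ∀ {c} {w : Vec Letter n} → ¬ Path j c (L ∷ w)
  ¬path-L {w = w} ((l , _) , _) = ℕ.m≢1+n+m j (sym l)

  pathTerm : Bool → ℕ → ℕ → ℕ → ℕ → ℕ → Vec Letter n → ℤ
  pathTerm f a i c m k w = when (does (path? i c w)) (weight f a w m k)

  pathSum : Bool → ∀ n → ℕ → ℕ → ℕ → Series
  pathSum f n a i c m k = ∑ (words n) (pathTerm f a i c m k)

  pathSum-[] : ∀ f a → d ≤ b j → pathSum f 0 a j d ≐ δ
  pathSum-[] f a d≤b m k =
    trans (ℤ.+-identityʳ _)
      (cong (λ b → when b (δ m k))
        (dec-true (path? j d [])
          ((refl , refl) , λ { zero → subst (_≤ b j) (sym (ℕ.+-identityʳ d)) d≤b })))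

  pathSum-outside : ∀ f n a i c → ¬ (c ≤ d × c ≤ b i) → pathSum f n a i c ≐ 𝟘
  pathSum-outside f n a i c out m k =
    trans (∑-cong (words n) λ w →
             cong (λ b → when b (weight f a w m k))
                  (dec-false (path? i c w) λ p → out (path-inside {w = w} p)))
          (∑-0 (words n))

  pathSum-R : ∀ f n a i c m k →
    ∑ (words n) (pathTerm f a i c m k ∘ (R ∷_))
      ≡ pathSum true n (suc a) i (suc c) m k
  pathSum-R f n a i c m k = ∑-cong (words n) λ w →
    cong (λ b → when b (weight true (suc a) w m k))
         (does-⇔ (path-R {w = w}) (path? i c (R ∷ w)) (path? i (suc c) w))

  pathSum-top : ∀ f n a c → pathSum f (suc n) a j c ≐ pathSum true n (suc a) j (suc c)
  pathSum-top f n a c m k =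
    trans (∑-words n (pathTerm f a j c m k))
      (trans (cong₂ _⊕_
               (trans (∑-cong (words n) λ w →
                         cong (λ b → when b (weight f a (L ∷ w) m k))
                              (dec-false (path? j c (L ∷ w)) (¬path-L {w = w})))
                      (∑-0 (words n)))
               (pathSum-R f n a j c m k))
             (ℤ.+-identityˡ _))

  pathSum-suc : ∀ f n a i c → c ≤ b (suc i) →
    pathSum f (suc n) a (suc i) c
      ≐ mul-qᵃt-if f a (pathSum false n (suc a) i c) ⊞ pathSum true n (suc a) (suc i) (suc c)
  pathSum-suc f n a i c c≤b m k =
    trans (∑-words n (pathTerm f a (suc i) c m k)) (cong₂ _⊕_
      (trans (∑-cong (words n) λ w →
                cong (λ b → when b (mul-qᵃt-if f a (weight false (suc a) w) m k))
                     (does-⇔ (path-L {w = w} c≤b) (path? (suc i) c (L ∷ w)) (path? i c w)))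
             (mul-qᵃt-if-∑ f a (words n) (λ w → does (path? i c w)) (weight false (suc a)) m k))
      (pathSum-R f n a (suc i) c m k))

-- Weak chains in a skew shape

_≟ᶜ_ : (x y : Cell) → Dec (x ≡ y)
_≟ᶜ_ = ≡-dec _≟_ _≟_

_⊑?_ : (x y : Cell) → Dec (x ⊑ y)
(i , c) ⊑? (j , d) = (j ≤? i) ×-dec (c ≤? d)

-- One region for both posets: `F` takes `I = r` and `C = 0`, while an interval takes the row and
-- column of its least cell. The corner `(j , d)` is the maximum.
InShape : (b : ℕ → ℕ) (j d I C : ℕ) → Cell → Set
InShape b j d I C (i , c) = (j ≤ i × i ≤ I) × (i ≤ c × C ≤ c) × (c ≤ d × c ≤ b i)

-- Ranks are relative to s.
record SkewShape (b : ℕ → ℕ) (j d I C s : ℕ) : Set where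
  field
    cells      : List Cell
    unique     : Unique cells
    complete   : ∀ {x} → InShape b j d I C x → x ∈ cells
    sound      : ∀ {x} → x ∈ cells → InShape b j d I C x
    decreasing : ∀ {i} → j ≤ i → i < I → b (suc i) ≤ b i
    corner     : d ≤ b j

  rank : Cell → ℕ
  rank x = cellRank x ∸ s

  open Paths b j d public

  -- The cell x need not belong to the shape.
  chains : Cell → Series
  chains x zero    k = δ zero k
  chains x (suc m) k = ∑ cells λ z → when (does (x ⊑? z)) (shift (rank z) (chains z m) k)

  extended : ℕ → ℕ → Cell → ℤ
  extended m k z = shift (rank z) (chains z m) k

  rowAbove? : ∀ (x z : Cell) → Dec (proj₁ z ≡ proj₁ x × proj₂ x ≤ proj₂ z)
  rowAbove? (i , c) (i′ , c′) = (i′ ≟ i) ×-dec (c ≤? c′)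

  -- The chains whose least cell lies in the row of x, at or beyond its column;
  -- the empty chain is put in row j, which makes chains and rowChains agree there.
  rowChains : Cell → Series
  rowChains x zero    k = when (does (proj₁ x ≟ j)) (δ zero k)
  rowChains x (suc m) k = ∑ cells λ z → when (does (rowAbove? x z)) (extended m k z)

  chains-suc : ∀ {i c} → j ≤ i →
    chains (suc i , c) ≐ chains (i , c) ⊞ rowChains (suc i , c)
  chains-suc {i} {c} j≤i zero k =
    sym (trans (cong (λ b → δ 0 k ⊕ when b (δ 0 k))
                     (dec-false (suc i ≟ j) λ { refl → ℕ.1+n≰n j≤i }))
               (ℤ.+-identityʳ _))
  chains-suc {i} {c} j≤i (suc m) k =
    trans (∑-cong cells λ z → when-⊎ ((suc i , c) ⊑? z) ((i , c) ⊑? z) (rowAbove? (suc i , c) z)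
             split (λ (p , q) → ℕ.m≤n⇒m≤1+n p , q) (λ (p , q) → ℕ.≤-reflexive p , q)
             (λ { ((p , _) , (refl , _)) → ℕ.1+n≰n p }) (extended m k z))
          (∑-⊕ cells (λ z → when (does ((i , c) ⊑? z)) (extended m k z))
                     (λ z → when (does (rowAbove? (suc i , c) z)) (extended m k z)))
    where
    split : ∀ {z} → (suc i , c) ⊑ z → (i , c) ⊑ z ⊎ (proj₁ z ≡ suc i × c ≤ proj₂ z)
    split (p , q) with ℕ.m≤n⇒m<n∨m≡n p
    ... | inj₁ (s≤s p′) = inj₁ (p′ , q)
    ... | inj₂ e        = inj₂ (e , q)

  chains-top : ∀ {c} → chains (j , c) ≐ rowChains (j , c)
  chains-top zero k = cong (λ b → when b (δ 0 k)) (sym (dec-true (j ≟ j) refl))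
  chains-top {c} (suc m) k = ∑-cong-∈ cells λ z z∈ →
    cong (λ b → when b _)
      (does-⇔ (mk⇔ (λ (p , q) → ℕ.≤-antisym p (proj₁ (proj₁ (sound z∈))) , q)
                    (λ (p , q) → ℕ.≤-reflexive p , q))
              ((j , c) ⊑? z) (rowAbove? (j , c) z))

  -- Membership of `(i , c)` in the shape enters here: the chains that begin at this cell come from
  -- exactly one entry of `cells`, isolated by `∑-delta`.
  rowChains-suc : ∀ {i c} → InShape b j d I C (i , c) →
    rowChains (i , c) ≐ mul-qᵃt (rank (i , c)) (chains (i , c)) ⊞ rowChains (i , suc c)
  rowChains-suc in-shape zero k = sym (ℤ.+-identityˡ _)
  rowChains-suc {i} {c} in-shape (suc m) k =
    trans (∑-cong cells λ z → when-⊎ (rowAbove? (i , c) z) (z ≟ᶜ (i , c)) (rowAbove? (i , suc c) z)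
             split (λ { refl → refl , ℕ.≤-refl }) (λ (p , q) → p , ℕ.<⇒≤ q)
             (λ { (refl , (_ , q)) → ℕ.1+n≰n q }) (extended m k z))
      (trans (∑-⊕ cells (λ z → when (does (z ≟ᶜ (i , c))) (extended m k z))
                        (λ z → when (does (rowAbove? (i , suc c) z)) (extended m k z)))
             (cong (_⊕ rowChains (i , suc c) (suc m) k)
                   (∑-delta _≟ᶜ_ unique (extended m k) (complete in-shape))))
    where
    split : ∀ {z} → proj₁ z ≡ i × c ≤ proj₂ z → z ≡ (i , c) ⊎ (proj₁ z ≡ i × suc c ≤ proj₂ z)
    split (refl , q) with ℕ.m≤n⇒m<n∨m≡n q
    ... | inj₁ q′   = inj₂ (refl , q′)
    ... | inj₂ refl = inj₁ refl

  -- Beyond the end of a row no first cell is available, so only the empty chain can remain, and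
  -- that one is assigned to row `j`.
  rowChains-outside : ∀ {i c} → ¬ (c ≤ d × c ≤ b i) →
    ∀ m k → rowChains (i , c) m k ≡ when (does (i ≟ j)) (δ m k)
  rowChains-outside out zero    k = refl
  rowChains-outside {i} {c} out (suc m) k =
    trans (∑-cong-∈ cells λ z z∈ → cong (λ b → when b (extended m k z))
             (dec-false (rowAbove? (i , c) z) λ { (refl , q) → let (_ , _ , p , p′) = sound z∈ in
                out (ℕ.≤-trans q p , ℕ.≤-trans q p′) }))
      (trans (∑-0 cells) (sym (when-0 (does (i ≟ j)))))

-- Clearing the denominators along lattice paths

module _ {b : ℕ → ℕ} {j d I C s : ℕ} (S : SkewShape b j d I C s) where
  open SkewShape S

  -- A cell (i , c) of relative rank a from which lattice paths to (j , d) have n steps.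
  record Position (n a i c : ℕ) : Set where
    field
      row-lower : j ≤ i
      row-upper : i ≤ I
      col-lower : C ≤ c
      rank-eq   : i + s + a ≡ c
      length-eq : n + c + j ≡ i + d

    rank≡a : rank (i , c) ≡ a
    rank≡a = begin
      c ∸ i ∸ s            ≡⟨ ℕ.∸-+-assoc c i s ⟩
      c ∸ (i + s)          ≡⟨ cong (_∸ (i + s)) rank-eq ⟨
      i + s + a ∸ (i + s)  ≡⟨ ℕ.m+n∸m≡n (i + s) a ⟩
      a                    ∎

    inShape : c ≤ d × c ≤ b i → InShape b j d I C (i , c)
    inShape inside = (row-lower , row-upper) , (i≤c , col-lower) , inside
      where
      i≤c : i ≤ c
      i≤c = subst (i ≤_) rank-eq (ℕ.≤-trans (ℕ.m≤m+n i s) (ℕ.m≤m+n (i + s) a))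

    rowChains-step : c ≤ d × c ≤ b i →
      rowChains (i , c) ≐ mul-qᵃt a (chains (i , c)) ⊞ rowChains (i , suc c)
    rowChains-step inside m k =
      trans (rowChains-suc (inShape inside) m k)
        (cong (λ a → mul-qᵃt a (chains (i , c)) m k ⊕ rowChains (i , suc c) m k) rank≡a)

  open Position

  -- The target may lie off the shape. The additive `length-eq` still makes sense there, even when
  -- the column exceeds `d`.
  position-R : ∀ {n a i c} → Position (suc n) a i c → Position n (suc a) i (suc c)
  position-R {n} {a} {i} {c} p = record
    { row-lower = row-lower p
    ; row-upper = row-upper p
    ; col-lower = ℕ.m≤n⇒m≤1+n (col-lower p)
    ; rank-eq   = trans (ℕ.+-suc (i + s) a) (cong suc (rank-eq p))
    ; length-eq = trans (cong (_+ j) (ℕ.+-suc n c)) (length-eq p)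
    }

  position-L : ∀ {n a i c} → j ≤ i → Position (suc n) a (suc i) c → Position n (suc a) i c
  position-L {i = i} j≤i p = record
    { row-lower = j≤i
    ; row-upper = ℕ.<⇒≤ (row-upper p)
    ; col-lower = col-lower p
    ; rank-eq   = trans (ℕ.+-suc (i + s) _) (rank-eq p)
    ; length-eq = ℕ.suc-injective (length-eq p)
    }

  -- With no steps left, `c + j ≡ i + d`; since `c ≤ d` and `j ≤ i`, both must be equalities.
  position-end : ∀ {a i c} → c ≤ d → Position 0 a i c → i ≡ j × c ≡ d
  position-end {i = i} {c} c≤d p = i≡j , ℕ.+-cancelʳ-≡ j c d
    (trans (length-eq p) (trans (cong (_+ d) i≡j) (ℕ.+-comm j d)))
    where
    i≤j : i ≤ j
    i≤j = ℕ.+-cancelʳ-≤ d i j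
      (subst (_≤ j + d) (length-eq p)
        (subst (_≤ j + d) (ℕ.+-comm j c) (ℕ.+-monoʳ-≤ j c≤d)))
    i≡j : i ≡ j
    i≡j = ℕ.≤-antisym i≤j (row-lower p)

  -- In row `j` the length equation reads `n + c ≡ d`, so a position in the top row is never off the
  -- shape.
  position-top : ∀ {n a c} → Position n a j c → c ≤ d × c ≤ b j
  position-top {n} {c = c} p = c≤d , ℕ.≤-trans c≤d corner
    where
    c≤d : c ≤ d
    c≤d = subst (c ≤_)
      (ℕ.+-cancelʳ-≡ j (n + c) d (trans (length-eq p) (ℕ.+-comm j d)))
      (ℕ.m≤n+m c n)

  pathSum-top-flag : ∀ n a c → pathSum false n a j c ≐ pathSum true n a j c
  pathSum-top-flag zero    a c m k = refl
  pathSum-top-flag (suc n) a c m k =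
    trans (pathSum-top false n a c m k) (sym (pathSum-top true n a c m k))

  private
    mul-1-qᵃt-step : ∀ a {f g} → f ≐ mul-qᵃt a f ⊞ g → mul-1-qᵃt a f ≐ g
    mul-1-qᵃt-step a {f} {g} e m k =
      trans (cong (_⊕ - mul-qᵃt a f m k) (e m k)) (cancel (mul-qᵃt a f m k) (g m k))
      where
      cancel : ∀ x y → x ⊕ y ⊕ - x ≡ y
      cancel = solve-∀

    -- The recursion says (1 - qᵃt) f = g, and the factor for `a` is commuted inwards past the
    -- others to use it.
    mul-∏-step : ∀ n a {f g} → f ≐ mul-qᵃt a f ⊞ g → mul-∏ (suc n) a f ≐ mul-∏ n (suc a) g
    mul-∏-step n a {f} e m k =
      trans (sym (mul-∏-mul-1-qᵃt n (suc a) a f m k)) (mul-∏-cong n (suc a) (mul-1-qᵃt-step a e) m k)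

  -- Mutual induction on the number of steps. At a given `n` the row version may call the chain
  -- version, but the chain version calls both only at the predecessor, so the recursion is well
  -- founded.
  chains-numerator : ∀ n {a i c} → Position n a i c → c ≤ d × c ≤ b i →
    mul-∏ n a (chains (i , c)) ≐ pathSum false n a i c
  rowChains-numerator : ∀ n {a i c} → Position n a i c →
    mul-∏ n a (rowChains (i , c)) ≐ pathSum true n a i c

  chains-numerator zero {a} p inside m k with refl , refl ← position-end (proj₁ inside) p =
    trans (mul-1-qᵃt-step a {chains (j , d)} {δ} (λ m k →
             trans (chains-top m k)
               (trans (rowChains-step p inside m k)
                 (cong (mul-qᵃt a (chains (j , d)) m k ⊕_)
                   -- The cell `(j , suc d)` is past the end of the top row; the empty chain left
                   -- there supplies the constant term `δ`.
                   (trans (rowChains-outside (λ (q , _) → ℕ.1+n≰n q) m k)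
                          (cong (λ b → when b (δ m k)) (dec-true (j ≟ j) refl)))))) m k)
          (sym (pathSum-[] false a corner m k))
  chains-numerator (suc n) {a} {i} {c} p inside m k with ℕ.m≤n⇒m<n∨m≡n (row-lower p)
  ... | inj₂ refl =
    trans (mul-∏-step n a {chains (j , c)} (λ m k →
             trans (chains-top m k) (rowChains-step p inside m k)) m k)
      (trans (rowChains-numerator n (position-R p) m k)
             (sym (pathSum-top false n a c m k)))
  chains-numerator (suc n) {a} {suc i} {c} p (c≤d , c≤b) m k | inj₁ (s≤s j≤i) =
    trans (mul-∏-step n a {chains (suc i , c)} {chains (i , c) ⊞ rowChains (suc i , suc c)} (λ m k →
             trans (chains-suc j≤i m k)
               (trans (cong (chains (i , c) m k ⊕_) (rowChains-step p (c≤d , c≤b) m k))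
                      (exchange (chains (i , c) m k) (mul-qᵃt a (chains (suc i , c)) m k)
                                (rowChains (suc i , suc c) m k)))) m k)
      (trans (mul-∏-⊞ n (suc a) (chains (i , c)) (rowChains (suc i , suc c)) m k)
        (trans (cong₂ _⊕_
                 (chains-numerator n (position-L j≤i p)
                   (c≤d , ℕ.≤-trans c≤b (decreasing j≤i (row-upper p))) m k)
                 (rowChains-numerator n (position-R p) m k))
               (sym (pathSum-suc false n a i c c≤b m k))))
    where
    exchange : ∀ x y z → x ⊕ (y ⊕ z) ≡ y ⊕ (x ⊕ z)
    exchange = solve-∀

  rowChains-numerator n {a} {i} {c} p m k with ℕ.m≤n⇒m<n∨m≡n (row-lower p)
  ... | inj₂ refl =
    trans (mul-∏-cong n a (λ m k → sym (chains-top m k)) m k)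
      (trans (chains-numerator n p (position-top p) m k) (pathSum-top-flag n a c m k))
  ... | inj₁ j<i with (c ≤? d) ×-dec (c ≤? b i)
  -- Both sides are zero: the empty chain is not counted in a row below the top one, and no path
  -- starts off the shape.
  ... | no outside =
    trans (mul-∏-cong n a {g = 𝟘} (λ m k →
             trans (rowChains-outside outside m k)
                   (cong (λ b → when b (δ m k))
                         (dec-false (i ≟ j) λ i≡j → ℕ.<⇒≢ j<i (sym i≡j)))) m k)
      (trans (mul-∏-𝟘 n a m k) (sym (pathSum-outside true n a i c outside m k)))
  rowChains-numerator zero p m k | inj₁ j<i | yes inside =
    contradiction (sym (proj₁ (position-end (proj₁ inside) p))) (ℕ.<⇒≢ j<i)
  rowChains-numerator (suc n) {a} {suc i} {c} p m k
    | inj₁ (s≤s j≤i) | yes inside@(c≤d , c≤b) = begin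
    mul-∏ (suc n) a (rowChains (suc i , c)) m k
      ≡⟨ mul-∏-cong (suc n) a (rowChains-step p inside) m k ⟩
    mul-∏ (suc n) a (mul-qᵃt a (chains (suc i , c)) ⊞ rowChains (suc i , suc c)) m k
      ≡⟨ mul-∏-⊞ (suc n) a (mul-qᵃt a (chains (suc i , c))) (rowChains (suc i , suc c)) m k ⟩
    mul-∏ (suc n) a (mul-qᵃt a (chains (suc i , c))) m k
        ⊕ mul-∏ (suc n) a (rowChains (suc i , suc c)) m k
      ≡⟨ cong₂ _⊕_
           (trans (mul-∏-mul-qᵃt (suc n) a a (chains (suc i , c)) m k)
             (mul-qᵃt-cong a (λ m k → trans (chains-numerator (suc n) p inside m k)
                                            (pathSum-suc false n a i c c≤b m k)) m k))
           (mul-1-qᵃt-cong a (rowChains-numerator n (position-R p)) m k) ⟩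
    -- The term qᵃt y from the chains at this cell cancels against the factor (1 - qᵃt) of the rest
    -- of the row, so only paths turning to `L` keep qᵃt.
    mul-qᵃt a (x ⊞ y) m k ⊕ (y m k ⊕ - mul-qᵃt a y m k)
      ≡⟨ cong (_⊕ (y m k ⊕ - mul-qᵃt a y m k)) (mul-qᵃt-⊞ a x y m k) ⟩
    mul-qᵃt a x m k ⊕ mul-qᵃt a y m k ⊕ (y m k ⊕ - mul-qᵃt a y m k)
      ≡⟨ cancel (mul-qᵃt a x m k) (mul-qᵃt a y m k) (y m k) ⟩
    mul-qᵃt a x m k ⊕ y m k
      ≡⟨ pathSum-suc true n a i c c≤b m k ⟨
    pathSum true (suc n) a (suc i) c m k ∎
    where
    x y : Series
    x = pathSum false n (suc a) i c
    y = pathSum true n (suc a) (suc i) (suc c)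
    cancel : ∀ u v w → u ⊕ v ⊕ (w ⊕ - v) ≡ u ⊕ w
    cancel = solve-∀

-- Cauchy products with the denominator

∑-neg : (xs : List X) (f : X → ℤ) → ∑ xs (λ x → - f x) ≡ - ∑ xs f
∑-neg []       f = refl
∑-neg (x ∷ xs) f = trans (cong (- f x ⊕_) (∑-neg xs f)) (sym (ℤ.neg-distrib-+ (f x) (∑ xs f)))

∑-upTo-suc : ∀ n (f : ℕ → ℤ) → ∑ (upTo (suc n)) f ≡ f 0 ⊕ ∑ (upTo n) (f ∘ suc)
∑-upTo-suc n f = cong (f 0 ⊕_)
  (trans (cong (λ xs → ∑ xs f) (sym (map-upTo suc n))) (∑-map suc (upTo n) f))

infixl 7 _*₁_ _*₂_

_*₁_ : (ℕ → ℤ) → (ℕ → ℤ) → ℕ → ℤ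
_*₁_ = RawRing._*_ (series ℤ.+-*-rawRing)

_*₂_ : Series → Series → Series
_*₂_ = RawRing._*_ ℤ⟦q⟧⟦t⟧

-- Peeling off the lowest coefficient replaces `f` by `f ∘ suc`, which is why the inductions below
-- keep the left factor general.
*₁-suc : ∀ f g k → (f *₁ g) (suc k) ≡ f 0 ⊗ g (suc k) ⊕ ((f ∘ suc) *₁ g) k
*₁-suc f g k = ∑-upTo-suc (suc k) (λ e → f e ⊗ g (suc k ∸ e))

*₁-cong : ∀ f {g h} → (∀ k → g k ≡ h k) → ∀ k → (f *₁ g) k ≡ (f *₁ h) k
*₁-cong f e k = ∑-cong (upTo (suc k)) λ i → cong (f i ⊗_) (e (k ∸ i))

*₁-0 : ∀ f k → (f *₁ (λ _ → + 0)) k ≡ + 0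
*₁-0 f k = trans (∑-cong (upTo (suc k)) λ i → ℤ.*-zeroʳ (f i)) (∑-0 (upTo (suc k)))

*₁-sub : ∀ f g h k → (f *₁ (λ k → g k ⊕ - h k)) k ≡ (f *₁ g) k ⊕ - (f *₁ h) k
*₁-sub f g h k =
  trans (∑-cong (upTo (suc k)) λ i → distrib (f i) (g (k ∸ i)) (h (k ∸ i)))
    (trans (∑-⊕ (upTo (suc k)) (λ i → f i ⊗ g (k ∸ i)) (λ i → - (f i ⊗ h (k ∸ i))))
           (cong ((f *₁ g) k ⊕_) (∑-neg (upTo (suc k)) (λ i → f i ⊗ h (k ∸ i)))))
  where
  distrib : ∀ x y z → x ⊗ (y ⊕ - z) ≡ x ⊗ y ⊕ - (x ⊗ z)
  distrib = solve-∀

*₁-shift : ∀ a f g k → (f *₁ shift a g) k ≡ shift a (f *₁ g) k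
*₁-shift zero    f g k = refl
*₁-shift (suc a) f g k = begin
  (f *₁ shift (suc a) g) k        ≡⟨ *₁-cong f (shift-suc a g) k ⟩
  (f *₁ shift a (shift 1 g)) k    ≡⟨ *₁-shift a f (shift 1 g) k ⟩
  shift a (f *₁ shift 1 g) k      ≡⟨ shift-cong a (one f) k ⟩
  shift a (shift 1 (f *₁ g)) k    ≡⟨ shift-suc a (f *₁ g) k ⟨
  shift (suc a) (f *₁ g) k        ∎
  where
  one : ∀ f k → (f *₁ shift 1 g) k ≡ shift 1 (f *₁ g) k
  one f zero          = trans (ℤ.+-identityʳ _) (ℤ.*-zeroʳ (f 0))
  one f (suc zero)    = trans (*₁-suc f (shift 1 g) 0) (cong (f 0 ⊗ g 0 ⊕_) (one (f ∘ suc) 0))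
  one f (suc (suc k)) = trans (*₁-suc f (shift 1 g) (suc k))
    (trans (cong (f 0 ⊗ g (suc k) ⊕_) (one (f ∘ suc) (suc k))) (sym (*₁-suc f g k)))

*₁-δ : ∀ f k → (f *₁ δ 0) k ≡ f k
*₁-δ f zero    = trans (ℤ.+-identityʳ _) (ℤ.*-identityʳ (f 0))
*₁-δ f (suc k) = trans (*₁-suc f (δ 0) k)
  (trans (cong₂ _⊕_ (ℤ.*-zeroʳ (f 0)) (*₁-δ (f ∘ suc) k)) (ℤ.+-identityˡ _))

*₂-∑ : ∀ f g m k → (f *₂ g) m k ≡ ∑ (upTo (suc m)) (λ l → (f l *₁ g (m ∸ l)) k)
*₂-∑ f g m k = pointwise (upTo (suc m))
  where
  open RingOps (series ℤ.+-*-rawRing) using () renaming (∑ to ∑₁)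
  pointwise : ∀ is → ∑₁ is (λ l → f l *₁ g (m ∸ l)) k ≡ ∑ is (λ l → (f l *₁ g (m ∸ l)) k)
  pointwise []       = refl
  pointwise (l ∷ is) = cong ((f l *₁ g (m ∸ l)) k ⊕_) (pointwise is)

*₂-suc : ∀ f g m k → (f *₂ g) (suc m) k ≡ (f 0 *₁ g (suc m)) k ⊕ ((f ∘ suc) *₂ g) m k
*₂-suc f g m k =
  trans (*₂-∑ f g (suc m) k)
    (trans (∑-upTo-suc (suc m) (λ l → (f l *₁ g (suc m ∸ l)) k))
           (cong ((f 0 *₁ g (suc m)) k ⊕_) (sym (*₂-∑ (f ∘ suc) g m k))))

*₂-zero : ∀ f g k → (f *₂ g) 0 k ≡ (f 0 *₁ g 0) k
*₂-zero f g k = ℤ.+-identityʳ _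

*₂-cong : ∀ f {g h} → g ≐ h → f *₂ g ≐ f *₂ h
*₂-cong f {g} {h} e m k =
  trans (*₂-∑ f g m k)
    (trans (∑-cong (upTo (suc m)) λ l → *₁-cong (f l) (e (m ∸ l)) k) (sym (*₂-∑ f h m k)))

*₂-mul-qᵃt : ∀ a f g → f *₂ mul-qᵃt a g ≐ mul-qᵃt a (f *₂ g)
*₂-mul-qᵃt a f g zero k = trans (*₂-zero f (mul-qᵃt a g) k) (*₁-0 (f 0) k)
*₂-mul-qᵃt a f g (suc zero) k =
  trans (*₂-suc f (mul-qᵃt a g) 0 k)
    (trans (cong₂ _⊕_ (*₁-shift a (f 0) (g 0) k) (*₂-mul-qᵃt a (f ∘ suc) g 0 k))
      (trans (ℤ.+-identityʳ _) (shift-cong a (λ k → sym (*₂-zero f g k)) k)))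
*₂-mul-qᵃt a f g (suc (suc m)) k =
  trans (*₂-suc f (mul-qᵃt a g) (suc m) k)
    (trans (cong₂ _⊕_ (*₁-shift a (f 0) (g (suc m)) k) (*₂-mul-qᵃt a (f ∘ suc) g (suc m) k))
      (trans (sym (shift-⊕ a (f 0 *₁ g (suc m)) (((f ∘ suc) *₂ g) m) k))
             (shift-cong a (λ k → sym (*₂-suc f g m k)) k)))

*₂-mul-1-qᵃt : ∀ a f g → f *₂ mul-1-qᵃt a g ≐ mul-1-qᵃt a (f *₂ g)
*₂-mul-1-qᵃt a f g m k = begin
  (f *₂ mul-1-qᵃt a g) m k
    ≡⟨ *₂-∑ f (mul-1-qᵃt a g) m k ⟩
  ∑ (upTo (suc m)) (λ l → (f l *₁ mul-1-qᵃt a g (m ∸ l)) k)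
    ≡⟨ ∑-cong (upTo (suc m)) (λ l → *₁-sub (f l) (g (m ∸ l)) (mul-qᵃt a g (m ∸ l)) k) ⟩
  ∑ (upTo (suc m)) (λ l → (f l *₁ g (m ∸ l)) k ⊕ - (f l *₁ mul-qᵃt a g (m ∸ l)) k)
    ≡⟨ ∑-⊕ (upTo (suc m)) (λ l → (f l *₁ g (m ∸ l)) k)
                          (λ l → - (f l *₁ mul-qᵃt a g (m ∸ l)) k) ⟩
  ∑ (upTo (suc m)) (λ l → (f l *₁ g (m ∸ l)) k)
      ⊕ ∑ (upTo (suc m)) (λ l → - (f l *₁ mul-qᵃt a g (m ∸ l)) k)
    ≡⟨ cong₂ _⊕_ (sym (*₂-∑ f g m k))
         (trans (∑-neg (upTo (suc m)) (λ l → (f l *₁ mul-qᵃt a g (m ∸ l)) k))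
                (cong -_ (sym (*₂-∑ f (mul-qᵃt a g) m k)))) ⟩
  (f *₂ g) m k ⊕ - (f *₂ mul-qᵃt a g) m k
    ≡⟨ cong (λ x → (f *₂ g) m k ⊕ - x) (*₂-mul-qᵃt a f g m k) ⟩
  mul-1-qᵃt a (f *₂ g) m k ∎

*₂-δ : ∀ f → f *₂ δ ≐ f
*₂-δ f zero    k = trans (*₂-zero f δ k) (*₁-δ (f 0) k)
*₂-δ f (suc m) k = trans (*₂-suc f δ m k)
  (trans (cong₂ _⊕_ (*₁-0 (f 0) k) (*₂-δ (f ∘ suc) m k)) (ℤ.+-identityˡ _))

-- Polynomials in q and t

private
  module ℤ[q,t] = RingOps ℤ[q,t]

monomial : ℤ → ℕ → ℕ → Poly 2
monomial c a l = (c , a ∷ l ∷ []) ∷ []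

coeff-++ : ∀ {n} (f g : Poly n) e → coeff (f ++ g) e ≡ coeff f e ⊕ coeff g e
coeff-++ []      g e = sym (ℤ.+-identityˡ _)
coeff-++ ((c , d) ∷ f) g e =
  trans (cong (x ⊕_) (coeff-++ f g e)) (sym (ℤ.+-assoc x (coeff f e) (coeff g e)))
  where
  x : ℤ
  x = when (does (Vec.≡-dec _≟_ d e)) c

coeff-∑ : ∀ {n} (xs : List X) (f : X → Poly n) e →
  coeff (RingOps.∑ (polyRing n) xs f) e ≡ ∑ xs (λ x → coeff (f x) e)
coeff-∑         []       f e = refl
coeff-∑ {n = n} (x ∷ xs) f e = trans (coeff-++ (f x) _ e) (cong (coeff (f x) e ⊕_) (coeff-∑ xs f e))

⟦1⟧ : ⟦ ℤ[q,t].1# ⟧ ≐ δ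
⟦1⟧ zero    zero    = refl
⟦1⟧ zero    (suc k) = refl
⟦1⟧ (suc m) zero    = refl
⟦1⟧ (suc m) (suc k) = refl

shift-≡ᵇ : ∀ a d b x k → shift a (λ k → when ((d ≡ᵇ k) ∧ b) x) k ≡ when ((a + d ≡ᵇ k) ∧ b) x
shift-≡ᵇ zero    d b x k       = refl
shift-≡ᵇ (suc a) d b x zero    = refl
shift-≡ᵇ (suc a) d b x (suc k) = shift-≡ᵇ a d b x k

⟦monomial⟧ : ∀ a a′ l → ⟦ monomial (+ 1) (a + a′) (suc l) ⟧ ≐ mul-qᵃt a ⟦ monomial (+ 1) a′ l ⟧
⟦monomial⟧ a a′ l zero    k = cong (_⊕ + 0)
  (trans (when-∧ (a + a′ ≡ᵇ k) false (+ 1)) (when-0 (a + a′ ≡ᵇ k)))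
⟦monomial⟧ a a′ l (suc m) k = sym
  (trans (shift-⊕ a (λ k → when ((a′ ≡ᵇ k) ∧ ((l ≡ᵇ m) ∧ true)) (+ 1)) (λ _ → + 0) k)
         (cong₂ _⊕_ (shift-≡ᵇ a a′ ((l ≡ᵇ m) ∧ true) (+ 1) k) (shift-0 a k)))

factor : ℕ → Poly 2
factor a = ℤ[q,t].1# ℤ[q,t].⊕ (ℤ[q,t].- (q ℤ[q,t].^ a ℤ[q,t].⊗ t))

q^ : ∀ a → q ℤ[q,t].^ a ≡ monomial (+ 1) a 0
q^ zero    = refl
q^ (suc a) = cong (q ℤ[q,t].⊗_) (q^ a)

-- Once qᵃ is rewritten to a monomial, `factor a` is a list of two terms and the product unfolds to
-- a copy of `p` followed by a negated, shifted copy. Multiplicativity of `⟦_⟧` in general is thus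
-- avoided.
factor-⟦⊗⟧ : ∀ a p → ⟦ factor a ℤ[q,t].⊗ p ⟧ ≐ mul-1-qᵃt a ⟦ p ⟧
factor-⟦⊗⟧ a p m k rewrite q^ a | ℕ.+-identityʳ a =
  trans (coeff-++ (List.map _ p) (List.map _ p ++ []) (k ∷ m ∷ []))
    (cong₂ _⊕_ (unit p)
      (trans (coeff-++ (List.map _ p) [] (k ∷ m ∷ []))
        (trans (ℤ.+-identityʳ _) (shifted p m))))
  where
  unit : ∀ p → coeff (List.map _ p) (k ∷ m ∷ []) ≡ ⟦ p ⟧ m k
  unit []                     = refl
  unit ((c , d ∷ e ∷ []) ∷ p) =
    cong₂ _⊕_ (cong (when ((d ≡ᵇ k) ∧ ((e ≡ᵇ m) ∧ true))) (ℤ.*-identityˡ c)) (unit p)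
  shifted : ∀ p m → coeff (List.map _ p) (k ∷ m ∷ []) ≡ - mul-qᵃt a ⟦ p ⟧ m k
  shifted []                     zero    = refl
  shifted []                     (suc m) = cong -_ (sym (shift-0 a k))
  shifted ((c , d ∷ e ∷ []) ∷ p) zero    =
    cong₂ _⊕_ (trans (when-∧ (a + d ≡ᵇ k) false _) (when-0 (a + d ≡ᵇ k))) (shifted p zero)
  shifted ((c , d ∷ e ∷ []) ∷ p) (suc m) = begin
    when ((a + d ≡ᵇ k) ∧ b) (-[1+ 0 ] ⊗ c) ⊕ _
      ≡⟨ cong₂ _⊕_ (cong (when ((a + d ≡ᵇ k) ∧ b)) (ℤ.-1*i≡-i c)) (shifted p (suc m)) ⟩
    when ((a + d ≡ᵇ k) ∧ b) (- c) ⊕ - shift a (⟦ p ⟧ m) k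
      ≡⟨ cong (_⊕ - shift a (⟦ p ⟧ m) k) (when-neg ((a + d ≡ᵇ k) ∧ b)) ⟩
    - when ((a + d ≡ᵇ k) ∧ b) c ⊕ - shift a (⟦ p ⟧ m) k
      ≡⟨ ℤ.neg-distrib-+ (when ((a + d ≡ᵇ k) ∧ b) c) _ ⟨
    - (when ((a + d ≡ᵇ k) ∧ b) c ⊕ shift a (⟦ p ⟧ m) k)
      ≡⟨ cong (λ x → - (x ⊕ shift a (⟦ p ⟧ m) k)) (shift-≡ᵇ a d b c k) ⟨
    - (shift a (λ k → when ((d ≡ᵇ k) ∧ b) c) k ⊕ shift a (⟦ p ⟧ m) k)
      ≡⟨ cong -_ (shift-⊕ a _ (⟦ p ⟧ m) k) ⟨
    - shift a (⟦ (c , d ∷ e ∷ []) ∷ p ⟧ m) k ∎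
    where
    b : Bool
    b = (e ≡ᵇ m) ∧ true
    when-neg : ∀ b → when b (- c) ≡ - when b c
    when-neg true  = refl
    when-neg false = refl

-- The tail of `applyUpTo g` is indexed by `g ∘ suc`, so the induction needs an arbitrary `g` with
-- values a, a+1, ...; the denominator is the case `g = id`.
*₂-∏-factor : ∀ n {a} {g : ℕ → ℕ} → (∀ e → g e ≡ a + e) → ∀ f →
  f *₂ ⟦ ℤ[q,t].∏ (applyUpTo g (suc n)) factor ⟧ ≐ mul-∏ n a f
*₂-∏-factor n {a} {g} eq f m k rewrite trans (eq 0) (ℕ.+-identityʳ a) =
  trans (*₂-cong f (factor-⟦⊗⟧ a (rest n)) m k)
    (trans (*₂-mul-1-qᵃt a f ⟦ rest n ⟧ m k) (remaining n))
  where
  rest : ℕ → Poly 2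
  rest n = ℤ[q,t].∏ (applyUpTo (g ∘ suc) n) factor
  remaining : ∀ n → mul-1-qᵃt a (f *₂ ⟦ rest n ⟧) m k ≡ mul-∏ n a f m k
  remaining zero    = mul-1-qᵃt-cong a (λ m k → trans (*₂-cong f ⟦1⟧ m k) (*₂-δ f m k)) m k
  remaining (suc n) = mul-1-qᵃt-cong a
    (*₂-∏-factor n (λ e → trans (eq (suc e)) (ℕ.+-suc a e)) f) m k

-- Principal specialization of sums of monomials

total : ∀ {n} → (Fin n → ℕ) → ℕ
total {zero}  β = 0
total {suc n} β = β zero + total (β ∘ suc)

unit : ∀ {n} → Fin n → Vec ℕ n
unit {n} j = Vec.replicate n 0 Vec.[ j ]≔ 1

-- The exponent of q after substituting t q^(α i) for the i-th variable; the constant weight 1 gives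
-- the exponent of t.
weighted : ∀ {n} → (Fin n → ℕ) → Vec ℕ n → ℕ
weighted α e = total (λ i → lookup e i * α i)

weighted-unit : ∀ {n} (α : Fin n → ℕ) j e →
  weighted α (Vec.zipWith _+_ (unit j) e) ≡ α j + weighted α e
weighted-unit α zero    (x ∷ e) =
  trans (cong (λ e → suc x * α zero + weighted (α ∘ suc) e) (Vec.zipWith-identityˡ (λ _ → refl) e))
        (ℕ.+-assoc (α zero) (x * α zero) _)
weighted-unit α (suc j) (x ∷ e) = begin
  x * α zero + weighted (α ∘ suc) (Vec.zipWith _+_ (unit j) e)
    ≡⟨ cong (λ y → x * α zero + y) (weighted-unit (α ∘ suc) j e) ⟩
  x * α zero + (α (suc j) + weighted (α ∘ suc) e)
    ≡⟨ ℕ.+-assoc (x * α zero) (α (suc j)) _ ⟨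
  x * α zero + α (suc j) + weighted (α ∘ suc) e
    ≡⟨ cong (_+ weighted (α ∘ suc) e) (ℕ.+-comm (x * α zero) (α (suc j))) ⟩
  α (suc j) + x * α zero + weighted (α ∘ suc) e
    ≡⟨ ℕ.+-assoc (α (suc j)) (x * α zero) _ ⟩
  α (suc j) + (x * α zero + weighted (α ∘ suc) e) ∎

weighted-0 : ∀ {n} (α : Fin n → ℕ) → weighted α (Vec.replicate n 0) ≡ 0
weighted-0 {zero}  α = refl
weighted-0 {suc n} α = weighted-0 (α ∘ suc)

monomial-^ : ∀ a e → monomial (+ 1) a 1 ℤ[q,t].^ e ≡ monomial (+ 1) (e * a) (e * 1)
monomial-^ a zero    = refl
monomial-^ a (suc e) = cong (monomial (+ 1) a 1 ℤ[q,t].⊗_) (monomial-^ a e)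

∏-monomial : ∀ {n} (g : Fin n → X) (u : X → Poly 2) (β γ : Fin n → ℕ) →
  (∀ i → u (g i) ≡ monomial (+ 1) (β i) (γ i)) →
  ℤ[q,t].∏ (tabulate g) u ≡ monomial (+ 1) (total β) (total γ)
∏-monomial {n = zero}  g u β γ eq = refl
∏-monomial {n = suc n} g u β γ eq =
  cong₂ ℤ[q,t]._⊗_ (eq zero) (∏-monomial (g ∘ suc) u (β ∘ suc) (γ ∘ suc) (eq ∘ suc))

exponents : ∀ {n} → List (Fin n) → Vec ℕ n
exponents {n} = foldr (λ j → Vec.zipWith _+_ (unit j)) (Vec.replicate n 0)

∏-var : ∀ {n} (js : List (Fin n)) → RingOps.∏ (polyRing n) js var ≡ (+ 1 , exponents js) ∷ []
∏-var {n} []       = refl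
∏-var {n} (j ∷ js) = cong (RawRing._*_ (polyRing n) (var j)) (∏-var js)

∑-∑ : ∀ {n} (xs : List X) (f : X → Poly n) (g : ℤ × Vec ℕ n → ℤ) →
  ∑ (RingOps.∑ (polyRing n) xs f) g ≡ ∑ xs (λ x → ∑ (f x) g)
∑-∑ []       f g = refl
∑-∑ (x ∷ xs) f g = trans (∑-++ (f x) _ g) (cong (∑ (f x) g ⊕_) (∑-∑ xs f g))

∑-nonneg : (xs : List X) {f : X → ℤ} → (∀ x → + 0 ℤ.≤ f x) → + 0 ℤ.≤ ∑ xs f
∑-nonneg []       p = ℤ.≤-refl
∑-nonneg (x ∷ xs) p = ℤ.+-mono-≤ (p x) (∑-nonneg xs p)

-- Each summand is a single monomial with coefficient 1, so every coefficient is a count.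
∑∏var-nonneg : ∀ {n} (xs : List X) (D : X → List (Fin n)) →
  NonnegativeCoefficients (RingOps.∑ (polyRing n) xs (λ x → RingOps.∏ (polyRing n) (D x) var))
∑∏var-nonneg {n = n} xs D e =
  subst (+ 0 ℤ.≤_) (sym (coeff-∑ xs (λ x → RingOps.∏ (polyRing n) (D x) var) e))
    (∑-nonneg xs λ x → subst (λ f → + 0 ℤ.≤ coeff f e) (sym (∏-var (D x)))
      (ℤ.+-mono-≤ (nonneg (does (Vec.≡-dec _≟_ (exponents (D x)) e))) ℤ.≤-refl))
  where
  nonneg : ∀ b → + 0 ℤ.≤ when b (+ 1)
  nonneg true  = ℤ.+≤+ z≤n
  nonneg false = ℤ.≤-refl

mul-qᵃts : (X → ℕ) → List X → Series
mul-qᵃts α = foldr (λ j → mul-qᵃt (α j)) δ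

module _ {n} (α : Fin n → ℕ) {v : Fin n → Poly 2} (v≡ : ∀ j → v j ≡ monomial (+ 1) (α j) 1) where

  private
    evalTerm : ℤ × Vec ℕ n → Poly 2
    evalTerm (c , e) =
      ℤ[q,t].fromℤ c ℤ[q,t].⊗ ℤ[q,t].∏ (allFin n) (λ i → v i ℤ[q,t].^ lookup e i)

    evalTerm-1 : ∀ e → evalTerm (+ 1 , e) ≡ monomial (+ 1) (weighted α e) (weighted (λ _ → 1) e)
    evalTerm-1 e = cong (ℤ[q,t].fromℤ (+ 1) ℤ[q,t].⊗_)
      (∏-monomial id (λ i → v i ℤ[q,t].^ lookup e i) (λ i → lookup e i * α i) (λ i → lookup e i * 1)
        λ i → trans (cong (ℤ[q,t]._^ lookup e i) (v≡ i)) (monomial-^ (α i) (lookup e i)))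

    ⟦exponents⟧ : ∀ js →
      ⟦ monomial (+ 1) (weighted α (exponents js)) (weighted (λ _ → 1) (exponents js)) ⟧ ≐ mul-qᵃts α js
    ⟦exponents⟧ [] m k
      rewrite weighted-0 α | weighted-0 {n} (λ _ → 1) = ⟦1⟧ m k
    ⟦exponents⟧ (j ∷ js) m k
      rewrite weighted-unit α j (exponents js) | weighted-unit (λ _ → 1) j (exponents js) =
      trans (⟦monomial⟧ (α j) (weighted α (exponents js)) (weighted (λ _ → 1) (exponents js)) m k)
            (mul-qᵃt-cong (α j) (⟦exponents⟧ js) m k)

  -- By `∏-var` each summand is literally a one-term list, so evaluation can be followed term by
  -- term, without showing that `eval` is a ring homomorphism.
  ⟦eval⟧ : (xs : List X) (D : X → List (Fin n)) →
    ⟦ eval ℤ[q,t] (RingOps.∑ (polyRing n) xs (λ x → RingOps.∏ (polyRing n) (D x) var)) v ⟧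
      ≐ λ m k → ∑ xs (λ x → mul-qᵃts α (D x) m k)
  ⟦eval⟧ xs D m k = begin
    coeff (RingOps.∑ ℤ[q,t] 𝒟 evalTerm) (k ∷ m ∷ [])
      ≡⟨ coeff-∑ 𝒟 evalTerm (k ∷ m ∷ []) ⟩
    ∑ 𝒟 (λ x → ⟦ evalTerm x ⟧ m k)
      ≡⟨ ∑-∑ xs (λ x → RingOps.∏ (polyRing n) (D x) var) (λ x → ⟦ evalTerm x ⟧ m k) ⟩
    ∑ xs (λ x → ∑ (RingOps.∏ (polyRing n) (D x) var) (λ y → ⟦ evalTerm y ⟧ m k))
      ≡⟨ ∑-cong xs (λ x → begin
           ∑ (RingOps.∏ (polyRing n) (D x) var) (λ y → ⟦ evalTerm y ⟧ m k)
             ≡⟨ cong (λ f → ∑ f (λ y → ⟦ evalTerm y ⟧ m k)) (∏-var (D x)) ⟩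
           ⟦ evalTerm (+ 1 , exponents (D x)) ⟧ m k ⊕ + 0
             ≡⟨ ℤ.+-identityʳ _ ⟩
           ⟦ evalTerm (+ 1 , exponents (D x)) ⟧ m k
             ≡⟨ cong (λ f → ⟦ f ⟧ m k) (evalTerm-1 (exponents (D x))) ⟩
           ⟦ monomial (+ 1) (weighted α (exponents (D x))) (weighted (λ _ → 1) (exponents (D x))) ⟧ m k
             ≡⟨ ⟦exponents⟧ (D x) m k ⟩
           mul-qᵃts α (D x) m k ∎) ⟩
    ∑ xs (λ x → mul-qᵃts α (D x) m k) ∎
    where
    𝒟 : Poly n
    𝒟 = RingOps.∑ (polyRing n) xs (λ x → RingOps.∏ (polyRing n) (D x) var)

t⊗q^ : ∀ a → t ℤ[q,t].⊗ q ℤ[q,t].^ a ≡ monomial (+ 1) a 1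
t⊗q^ a = cong (t ℤ[q,t].⊗_) (q^ a)

-- Matching descent sets with the recursive weight

isR : Letter → Bool
isR L = false
isR R = true

-- Common form of both descent sets, indexed from 0 by the letter `L`. Global descents are recorded
-- at that `L` with exponent `pos j ∸ 1`, local ones at the preceding `R` with exponent `pos p`;
-- either exponent is the 0-based index of the `L`.
Descent : ∀ {n} → Bool → Vec Letter n → Fin n → Set
Descent f w zero    = lookup w zero ≡ L × f ≡ true
Descent f w (suc i) = lookup w (suc i) ≡ L × lookup w (inject₁ i) ≡ R

descent-∷ : ∀ {n} f l (w : Vec Letter n) i → Descent f (l ∷ w) (suc i) ⇔ Descent (isR l) w i
descent-∷ f L w zero    = mk⇔ (λ { (_ , ()) }) (λ { (_ , ()) })
descent-∷ f R w zero    = mk⇔ (λ (p , _) → p , refl) (λ (p , _) → p , refl)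
descent-∷ f l w (suc i) = mk⇔ id id

weight-∷ : ∀ {n} l a (w : Vec Letter n) → weight false a (l ∷ w) ≡ weight (isR l) (suc a) w
weight-∷ L a w = refl
weight-∷ R a w = refl

-- Filtering the list and reading the word advance together; `g` is arbitrary because the tail of
-- `tabulate g` is `tabulate (g ∘ suc)`.
mul-qᵃts-descents : ∀ {n} f a (w : Vec Letter n) {P : Pred X 0ℓ} (P? : Decidable P)
  (g : Fin n → X) (α : X → ℕ) → (∀ i → P (g i) ⇔ Descent f w i) → (∀ i → α (g i) ≡ a + toℕ i) →
  mul-qᵃts α (filter P? (tabulate g)) ≡ weight f a w
mul-qᵃts-descents f a []      P? g α iff eq = refl
mul-qᵃts-descents f a (l ∷ w) P? g α iff eq
  with recurse ← mul-qᵃts-descents (isR l) (suc a) w P? (g ∘ suc) α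
         (λ i → descent-∷ f l w i ⇔-∘ iff (suc i)) (λ i → trans (eq (suc i)) (ℕ.+-suc a (toℕ i)))
  with P? (g zero)
mul-qᵃts-descents f     a (R ∷ w) P? g α iff eq | yes p with () ← proj₁ (Equivalence.to (iff zero) p)
mul-qᵃts-descents f     a (R ∷ w) P? g α iff eq | no ¬p = recurse
mul-qᵃts-descents false a (L ∷ w) P? g α iff eq | yes p with () ← proj₂ (Equivalence.to (iff zero) p)
mul-qᵃts-descents false a (L ∷ w) P? g α iff eq | no ¬p = recurse
mul-qᵃts-descents true  a (L ∷ w) P? g α iff eq | yes p =
  cong₂ mul-qᵃt (trans (eq zero) (ℕ.+-identityʳ a)) recurse
mul-qᵃts-descents true  a (L ∷ w) P? g α iff eq | no ¬p =
  contradiction (Equivalence.from (iff zero) (refl , refl)) ¬p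

at-suc : ∀ {n} (w : Vec Letter n) {k a} j → toℕ j ≡ k → w at suc k is a ⇔ lookup w j ≡ a
at-suc w j refl = mk⇔
  (λ (i , e , p) → trans (cong (lookup w) (sym (toℕ-injective (ℕ.suc-injective e)))) p)
  (λ p → j , refl , p)

global-descent : ∀ {n} (w : Vec Letter n) j →
  (w at pos j is L × (pos j ≡ 1 ⊎ w at (pos j ∸ 1) is R)) ⇔ Descent true w j
global-descent w zero    = at-suc w zero refl ×-⇔ mk⇔ (λ _ → refl) (λ _ → inj₁ refl)
global-descent w (suc j) = at-suc w (suc j) refl ×-⇔
  (at-suc w (inject₁ j) (toℕ-inject₁ j) ⇔-∘ mk⇔ (λ { (inj₁ ()) ; (inj₂ p) → p }) inj₂)

local-descent : ∀ {n} (w : Vec Letter (suc n)) p →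
  (w at pos p is R × w at suc (pos p) is L) ⇔ Descent false w (suc p)
local-descent w p =
  (at-suc w (suc p) refl ×-⇔ at-suc w (inject₁ p) (toℕ-inject₁ p)) ⇔-∘ mk⇔ swap swap

global-weight : ∀ {n} (w : Vec Letter n)
  (descent? : Decidable (λ j → w at pos j is L × (pos j ≡ 1 ⊎ w at (pos j ∸ 1) is R))) →
  mul-qᵃts (λ j → pos j ∸ 1) (filter descent? (allFin n)) ≡ weight true 0 w
global-weight w descent? =
  mul-qᵃts-descents true 0 w descent? id _ (global-descent w) (λ _ → refl)

local-weight : ∀ {h} (w : Vec Letter h)
  (descent? : Decidable (λ (p : Fin (h ∸ 1)) → w at pos p is R × w at suc (pos p) is L)) →
  mul-qᵃts pos (filter descent? (allFin (h ∸ 1))) ≡ weight false 0 w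
local-weight []      descent? = refl
-- With the flag `false` the first letter is no descent, so the comparison starts at the second one,
-- with exponent 1 and the flag set by `l`.
local-weight (l ∷ w) descent? =
  trans (mul-qᵃts-descents (isR l) 1 w descent? id pos
          (λ p → descent-∷ false l w p ⇔-∘ local-descent (l ∷ w) p) (λ _ → refl))
        (sym (weight-∷ l 0 w))

-- From graded posets to shapes of cells

var-^ : ∀ a → RingOps._^_ ℤ[q] (var zero) a ≡ (+ 1 , a ∷ []) ∷ []
var-^ zero    = refl
var-^ (suc a) = cong (RawRing._*_ ℤ[q] (var zero)) (var-^ a)

-- The carriers of `F` and of its intervals attach membership proofs that their equality ignores.
-- Passing to bare cells turns this equality into `≡`, on which the counting works.
record CellPoset (P : GradedPoset) (b : ℕ → ℕ) (j d I C s : ℕ) : Set where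
  private
    module P = GradedPoset P

  field
    cell       : P.Carrier → Cell
    ≈⇔≡        : ∀ {x y} → x P.≈ y ⇔ cell x ≡ cell y
    ≼⇔⊑        : ∀ {x y} → x P.≼ y ⇔ cell x ⊑ cell y
    in-shape   : ∀ z → InShape b j d I C (cell z)
    from-shape : ∀ {x} → InShape b j d I C x → ∃ λ z → x ≡ cell z
    rank≡      : ∀ z → P.rank z ≡ cellRank (cell z) ∸ s
    top≡       : cell P.top ≡ (j , d)
    decreasing : ∀ {i} → j ≤ i → i < I → b (suc i) ≤ b i
    corner     : d ≤ b j

  shape : SkewShape b j d I C s
  shape = record
    { cells      = List.map cell P.elements
    ; unique     = AllPairs.map⁺ (AllPairs.map (_∘ Equivalence.from ≈⇔≡) P.elements-unique)
    ; complete   = λ x∈ → let z , x≡z = from-shape x∈ in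
        Any.map⁺ (Any.map (λ z≈y → trans x≡z (Equivalence.to ≈⇔≡ z≈y)) (P.elements-complete z))
    ; sound      = λ x∈ → let z , _ , x≡z = ∈-map⁻ cell x∈ in
        subst (InShape b j d I C) (sym x≡z) (in-shape z)
    ; decreasing = decreasing
    ; corner     = corner
    }

  open SkewShape shape using (rank; chains; extended)

  private
    sumRanks : ∀ {m} → Vec P.Carrier m → ℕ
    sumRanks v = Vec.sum (Vec.map P.rank v)

    indicator : ∀ {m} → Vec P.Carrier m → ℕ → ℤ
    indicator v k = when ((sumRanks v ≡ᵇ k) ∧ true) (+ 1)

    -- The bound `x` need not come from the poset: for `F` it is `(r , 0)`, which is below every
    -- cell without belonging to the shape.
    ChainAbove : ∀ {m} → Cell → Vec P.Carrier m → Set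
    ChainAbove x []      = ⊤
    ChainAbove x (z ∷ v) = x ⊑ cell z × Linked P._≼_ (z ∷ v)

    chainAbove? : ∀ {m} x (v : Vec P.Carrier m) → Dec (ChainAbove x v)
    chainAbove? x []      = yes tt
    chainAbove? x (z ∷ v) = (x ⊑? cell z) ×-dec linked? P._≼?_ (z ∷ v)

    linked⇔ : ∀ {m} z (v : Vec P.Carrier m) → Linked P._≼_ (z ∷ v) ⇔ ChainAbove (cell z) v
    linked⇔ z []      = mk⇔ (λ _ → tt) (λ _ → [-])
    linked⇔ z (y ∷ v) = mk⇔ (λ { (p ∷ ps) → Equivalence.to ≼⇔⊑ p , ps })
                            (λ (p , ps) → Equivalence.from ≼⇔⊑ p ∷ ps)

    indicatorAbove : ∀ {m} → Cell → Vec P.Carrier m → ℕ → ℤ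
    indicatorAbove x v k = when (does (chainAbove? x v)) (indicator v k)

    -- The bound is arbitrary because the first entry of a chain becomes the bound for the rest.
    count-chains : ∀ m x k →
      ∑ (tuples P.elements m) (λ v → indicatorAbove x v k) ≡ chains x m k
    count-chains zero    x zero    = refl
    count-chains zero    x (suc k) = refl
    count-chains (suc m) x k = begin
      ∑ (tuples P.elements (suc m)) (λ v → indicatorAbove x v k)
        ≡⟨ ∑-cartesianProductWith _∷_ P.elements (tuples P.elements m)
             (λ v → indicatorAbove x v k) ⟩
      ∑ P.elements (λ z → ∑ (tuples P.elements m) λ v → indicatorAbove x (z ∷ v) k)
        ≡⟨ ∑-cong P.elements (λ z → trans
             (∑-cong (tuples P.elements m) λ v → split z v)
             (trans (∑-when (tuples P.elements m) (does (x ⊑? cell z)) _)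
               (cong (when (does (x ⊑? cell z)))
                 (trans (sym (shift-∑ (rank (cell z)) (tuples P.elements m) _ k))
                        (shift-cong (rank (cell z)) (count-chains m (cell z)) k))))) ⟩
      ∑ P.elements (λ z → when (does (x ⊑? cell z)) (shift (rank (cell z)) (chains (cell z) m) k))
        ≡⟨ ∑-map cell P.elements (λ z → when (does (x ⊑? z)) (extended m k z)) ⟨
      chains x (suc m) k ∎
      where
      split : ∀ z v → indicatorAbove x (z ∷ v) k
        ≡ when (does (x ⊑? cell z))
            (shift (rank (cell z)) (indicatorAbove (cell z) v) k)
      split z v = begin
        indicatorAbove x (z ∷ v) k
          ≡⟨ when-∧ (does (x ⊑? cell z)) _ _ ⟩
        when (does (x ⊑? cell z)) (when (does (linked? P._≼?_ (z ∷ v))) (indicator (z ∷ v) k))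
          ≡⟨ cong (when (does (x ⊑? cell z))) (begin
               when (does (linked? P._≼?_ (z ∷ v))) (indicator (z ∷ v) k)
                 ≡⟨ cong₂ when
                      (does-⇔ (linked⇔ z v) (linked? P._≼?_ (z ∷ v)) (chainAbove? (cell z) v))
                      (trans (cong (λ a → when ((a + sumRanks v ≡ᵇ k) ∧ true) (+ 1)) (rank≡ z))
                             (sym (shift-≡ᵇ (rank (cell z)) (sumRanks v) true (+ 1) k))) ⟩
               when (does (chainAbove? (cell z) v)) (shift (rank (cell z)) (indicator v) k)
                 ≡⟨ shift-when (rank (cell z)) (does (chainAbove? (cell z) v)) (indicator v) k ⟨
               shift (rank (cell z)) (indicatorAbove (cell z) v) k ∎) ⟩
        when (does (x ⊑? cell z))
          (shift (rank (cell z)) (indicatorAbove (cell z) v) k) ∎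

  ∑Aₘtᵐ-chains : ∀ {x} → (∀ z → x ⊑ cell z) → ∑Aₘtᵐ P ≐ chains x
  ∑Aₘtᵐ-chains {x} least m k = begin
    coeff (A P m) (k ∷ [])
      ≡⟨ coeff-∑ (weakChains P m) _ (k ∷ []) ⟩
    ∑ (weakChains P m) (λ v → coeff (RingOps._^_ ℤ[q] (var zero) (sumRanks v)) (k ∷ []))
      ≡⟨ ∑-cong (weakChains P m) {g = λ v → indicator v k} (λ v →
           trans (cong (λ f → coeff f (k ∷ [])) (var-^ (sumRanks v)))
                 (ℤ.+-identityʳ (indicator v k))) ⟩
    ∑ (weakChains P m) (λ v → indicator v k)
      ≡⟨ ∑-filter (linked? P._≼?_) (tuples P.elements m) (λ v → indicator v k) ⟩
    ∑ (tuples P.elements m) (λ v → when (does (linked? P._≼?_ v)) (indicator v k))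
      ≡⟨ ∑-cong (tuples P.elements m) (λ v →
           cong (λ b → when b (indicator v k))
                (does-⇔ (above v) (linked? P._≼?_ v) (chainAbove? x v))) ⟩
    ∑ (tuples P.elements m) (λ v → indicatorAbove x v k)
      ≡⟨ count-chains m x k ⟩
    chains x m k ∎
    where
    above : ∀ {m} (v : Vec P.Carrier m) → Linked P._≼_ v ⇔ ChainAbove x v
    above []      = mk⇔ (λ _ → tt) (λ _ → [])
    above (z ∷ v) = mk⇔ (λ p → least z , p) proj₂

  -- The rank of a cell grows as its row decreases and its column increases, so the corner attains
  -- the maximum.
  maxRank-top : ∀ {H} → rank (j , d) ≡ H → P.maxRank ≡ H
  maxRank-top refl = ℕ.≤-antisym
    (max≤v⁺ z≤n (All.map⁺ (All.universal (λ z →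
      subst (_≤ rank (j , d)) (sym (rank≡ z))
        (let (j≤i , _) , _ , (c≤d , _) = in-shape z in ℕ.∸-monoˡ-≤ s (ℕ.∸-mono c≤d j≤i)))
      P.elements)))
    (v≤max⁺ 0 _ (inj₂ (Any.map⁺ (Any.map (λ {z} top≈z → ℕ.≤-reflexive
      (trans (cong rank (trans (sym top≡) (Equivalence.to ≈⇔≡ top≈z))) (sym (rank≡ z))))
      (P.elements-complete P.top)))))

  isNumerator : ∀ {H x f} → rank (j , d) ≡ H → (∀ z → x ⊑ cell z) →
    mul-∏ H 0 (chains x) ≐ ⟦ f ⟧ → IsNumerator P f
  isNumerator {H} {x} {f} rank-top least eq m k = begin
    (∑Aₘtᵐ P *₂ ⟦ denominator P ⟧) m k
      ≡⟨ *₂-∏-factor P.maxRank {0} {id} (λ _ → refl) (∑Aₘtᵐ P) m k ⟩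
    mul-∏ P.maxRank 0 (∑Aₘtᵐ P) m k
      ≡⟨ cong (λ H → mul-∏ H 0 (∑Aₘtᵐ P) m k) (maxRank-top rank-top) ⟩
    mul-∏ H 0 (∑Aₘtᵐ P) m k
      ≡⟨ mul-∏-cong H 0 (∑Aₘtᵐ-chains least) m k ⟩
    mul-∏ H 0 (chains x) m k
      ≡⟨ eq m k ⟩
    ⟦ f ⟧ m k ∎

-- The intervals and the whole Ferrers poset

#L+#R : ∀ {n} (w : Vec Letter n) → (# L) w + (# R) w ≡ n
#L+#R []      = refl
#L+#R (L ∷ w) = cong suc (#L+#R w)
#L+#R (R ∷ w) = trans (ℕ.+-suc ((# L) w) ((# R) w)) (cong suc (#L+#R w))

module _ {r : ℕ} {b : ℕ → ℕ} (B : Bounds r b) where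
  open Bounds B
  open Ferrers B

  module LocalNumerator (x y : FCell) (x≤y : x ≤F y) where
    private
      i = row x
      c = col x
      j = row y
      d = col y
      P = interval x y x≤y
      j≤i = proj₁ x≤y
      c≤d = proj₂ x≤y
      open Local b i c j d using (h; 𝒲; D; 𝒟-specialized; isLocalWord?; descent?)

      1≤j = proj₁ (proj₁ (proj₂ y))
      i≤r = proj₂ (proj₁ (proj₂ x))
      i≤c = proj₁ (proj₂ (proj₂ x))
      c≤b = proj₂ (proj₂ (proj₂ x))

      cellPoset : CellPoset P b j d i c (c ∸ i)
      cellPoset = record
        { cell       = proj₁ ∘ proj₁
        ; ≈⇔≡        = mk⇔ id id
        ; ≼⇔⊑        = mk⇔ id id
        ; in-shape   = λ { (((_ , _) , _ , k≤e , e≤b) , (k≤i , c≤e) , (j≤k , e≤d)) →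
            (j≤k , k≤i) , (k≤e , c≤e) , (e≤d , e≤b) }
        ; from-shape = λ { {k , e} ((j≤k , k≤i) , (k≤e , c≤e) , (e≤d , e≤b)) →
            (((k , e) , (ℕ.≤-trans 1≤j j≤k , ℕ.≤-trans k≤i i≤r) , k≤e , e≤b) ,
              (k≤i , c≤e) , (j≤k , e≤d)) , refl }
        ; rank≡      = λ _ → refl
        ; top≡       = refl
        ; decreasing = λ {k} j≤k k<i → decreasing k (ℕ.≤-trans 1≤j j≤k) (ℕ.≤-trans k<i i≤r)
        ; corner     = proj₂ (proj₂ (proj₂ y))
        }

      open CellPoset cellPoset using (shape; isNumerator)
      open SkewShape shape using (rank; chains; path?; pathTerm)

      position : Position shape h 0 i c
      position = record
        { row-lower = j≤i
        ; row-upper = ℕ.≤-refl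
        ; col-lower = ℕ.≤-refl
        ; rank-eq   = trans (ℕ.+-identityʳ _) (ℕ.m+[n∸m]≡n i≤c)
        ; length-eq = begin
            (i ∸ j) + (d ∸ c) + c + j   ≡⟨ cong (_+ j) (ℕ.+-assoc (i ∸ j) (d ∸ c) c) ⟩
            (i ∸ j) + (d ∸ c + c) + j   ≡⟨ cong (λ d → i ∸ j + d + j) (ℕ.m∸n+n≡m c≤d) ⟩
            (i ∸ j) + d + j             ≡⟨ ℕ.+-assoc (i ∸ j) d j ⟩
            (i ∸ j) + (d + j)           ≡⟨ cong (λ e → i ∸ j + e) (ℕ.+-comm d j) ⟩
            (i ∸ j) + (j + d)           ≡⟨ ℕ.+-assoc (i ∸ j) j d ⟨
            (i ∸ j) + j + d             ≡⟨ cong (_+ d) (ℕ.m∸n+n≡m j≤i) ⟩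
            i + d                       ∎
        }

      rank-top : rank (j , d) ≡ h
      rank-top = begin
        d ∸ j ∸ (c ∸ i)
          ≡⟨ ℕ.∸-+-assoc d j (c ∸ i) ⟩
        d ∸ (j + (c ∸ i))
          ≡⟨ cong (_∸ (j + (c ∸ i))) d≡ ⟨
        j + (i ∸ j) + (c ∸ i) + (d ∸ c) ∸ (j + (c ∸ i))
          ≡⟨ cong (_∸ (j + (c ∸ i))) (rearrange j (i ∸ j) (c ∸ i) (d ∸ c)) ⟩
        j + (c ∸ i) + ((i ∸ j) + (d ∸ c)) ∸ (j + (c ∸ i))
          ≡⟨ ℕ.m+n∸m≡n (j + (c ∸ i)) _ ⟩
        (i ∸ j) + (d ∸ c) ∎
        where
        -- The truncated differences are exact because `j ≤ i`, `i ≤ c` and `c ≤ d`, and the sum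
        -- telescopes.
        d≡ : j + (i ∸ j) + (c ∸ i) + (d ∸ c) ≡ d
        d≡ = begin
          j + (i ∸ j) + (c ∸ i) + (d ∸ c)
            ≡⟨ cong (λ i′ → i′ + (c ∸ i) + (d ∸ c)) (ℕ.m+[n∸m]≡n j≤i) ⟩
          i + (c ∸ i) + (d ∸ c)
            ≡⟨ cong (_+ (d ∸ c)) (ℕ.m+[n∸m]≡n i≤c) ⟩
          c + (d ∸ c)
            ≡⟨ ℕ.m+[n∸m]≡n c≤d ⟩
          d ∎
        rearrange : ∀ u v w z → u + v + w + z ≡ u + w + (v + z)
        rearrange = ℕ.solve-∀

      subtract : ∀ {k m n} → m ≤ n → k ≡ n ∸ m ⇔ k + m ≡ n
      subtract {k} {m} {n} m≤n = mk⇔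
        (λ e → trans (cong (_+ m) e) (ℕ.m∸n+n≡m m≤n))
        (λ e → trans (sym (ℕ.m+n∸n≡m k m)) (cong (_∸ m) e))

      numerator : mul-∏ h 0 (chains (i , c)) ≐ ⟦ 𝒟-specialized ⟧
      numerator m k = begin
        mul-∏ h 0 (chains (i , c)) m k
          ≡⟨ chains-numerator shape h position (c≤d , c≤b) m k ⟩
        ∑ (words h) (pathTerm false 0 i c m k)
          ≡⟨ ∑-cong (words h) (λ w → cong₂ when
               (does-⇔ ((subtract j≤i ×-⇔ subtract c≤d) ×-⇔ mk⇔ id id) (isLocalWord? w) (path? i c w))
               (cong (λ f → f m k) (local-weight w (descent? w)))) ⟨
        ∑ (words h) (λ w → when (does (isLocalWord? w)) (mul-qᵃts pos (D w) m k))
          ≡⟨ ∑-filter isLocalWord? (words h) (λ w → mul-qᵃts pos (D w) m k) ⟨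
        ∑ 𝒲 (λ w → mul-qᵃts pos (D w) m k)
          ≡⟨ ⟦eval⟧ pos (λ p → t⊗q^ (pos p)) 𝒲 D m k ⟨
        ⟦ 𝒟-specialized ⟧ m k ∎

    local-numerator : IsNumerator P 𝒟-specialized
    local-numerator =
      isNumerator {f = 𝒟-specialized} rank-top (λ (_ , x≤z , _) → x≤z) numerator

  module GlobalNumerator where
    private
      module F = GradedPoset F
      open Global r b using (M; 𝒲; D; 𝒟-specialized; isGlobalWord?; descent?; ι)

      suc-M : suc M ≡ b 1
      suc-M = ℕ.m+[n∸m]≡n (diagonal 1 ℕ.≤-refl nonempty)

      cellPoset : CellPoset F b 1 (b 1) r 0 0
      cellPoset = record
        { cell       = proj₁
        ; ≈⇔≡        = mk⇔ id id
        ; ≼⇔⊑        = mk⇔ id id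
        ; in-shape   = λ { z@(_ , (1≤i , i≤r) , i≤c , c≤b) →
            (1≤i , i≤r) , (i≤c , z≤n) , (proj₂ (F.top-maximum z) , c≤b) }
        ; from-shape = λ { {i , c} (i≤ , (i≤c , _) , (_ , c≤b)) → ((i , c) , i≤ , i≤c , c≤b) , refl }
        ; rank≡      = λ _ → refl
        ; top≡       = refl
        ; decreasing = λ {i} 1≤i i<r → decreasing i 1≤i i<r
        ; corner     = ℕ.≤-refl
        }

      open CellPoset cellPoset using (shape; isNumerator)
      open SkewShape shape hiding (decreasing)

      -- Every diagonal cell has rank 0 and lies (i - 1) + (b 1 - i) = `M` steps from the top, so
      -- the words of all rows share the length `M`.
      position : ∀ {i} → 1 ≤ i → i ≤ r → Position shape M 0 i i
      position {i} 1≤i i≤r = record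
        { row-lower = 1≤i
        ; row-upper = i≤r
        ; col-lower = z≤n
        ; rank-eq   = trans (ℕ.+-identityʳ _) (ℕ.+-identityʳ _)
        ; length-eq = begin
            M + i + 1    ≡⟨ ℕ.+-comm (M + i) 1 ⟩
            suc M + i    ≡⟨ cong (_+ i) suc-M ⟩
            b 1 + i      ≡⟨ ℕ.+-comm (b 1) i ⟩
            i + b 1      ∎
        }

      -- Row `i` begins at column `i`, so column 0 imposes the same condition. This lets all rows be
      -- summed with the single column 0 in `chains-suc`.
      rowChains-diagonal : ∀ i → rowChains (i , 0) ≐ rowChains (i , i)
      rowChains-diagonal i zero    k = refl
      rowChains-diagonal i (suc m) k = ∑-cong-∈ cells λ z z∈ →
        cong (λ b → when b (extended m k z))
          (does-⇔ (mk⇔ (λ { (refl , _) → refl , proj₁ (proj₁ (proj₂ (sound z∈))) })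
                        (λ (p , _) → p , z≤n))
                  (rowAbove? (i , 0) z) (rowAbove? (i , i) z))

      word? : ∀ i (w : Vec Letter M) → Dec ((# L) w < i × StaysInside b (ι w) (ι w) w)
      word? i w = ((# L) w ℕ.<? i) ×-dec staysInside? b (ι w) (ι w) w

      wordTerm : ℕ → ℕ → ℕ → Vec Letter M → ℤ
      wordTerm i m k w = when (does (word? i w)) (weight true 0 w m k)

      -- The words added have exactly `i` letters `L` and thus start at the diagonal cell of row
      -- `suc i`. The number of letters `R` that `Path` demands follows from the length `M`.
      wordTerm-suc : ∀ i m k w →
        wordTerm (suc i) m k w ≡ wordTerm i m k w ⊕ pathTerm true 0 (suc i) (suc i) m k w
      wordTerm-suc i m k w =
        when-⊎ (word? (suc i) w) (word? i w) (path? (suc i) (suc i) w)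
          split (λ (l , s) → ℕ.m≤n⇒m≤1+n l , s)
          (λ ((l , _) , s) →
            ℕ.≤-reflexive (trans (ℕ.+-comm 1 _) l) ,
            subst (λ i → StaysInside b i i w) (sym l) s)
          (λ ((l , _) , ((e , _) , _)) → ℕ.<⇒≢ l (ℕ.suc-injective (trans (ℕ.+-comm 1 _) e)))
          (weight true 0 w m k)
        where
        split : (# L) w < suc i × StaysInside b (ι w) (ι w) w →
          ((# L) w < i × StaysInside b (ι w) (ι w) w) ⊎ Path (suc i) (suc i) w
        split (s≤s l , s) with ℕ.m≤n⇒m<n∨m≡n l
        ... | inj₁ l<i  = inj₁ (l<i , s)
        ... | inj₂ refl = inj₂ ((ℕ.+-comm _ 1 , (begin
          (# R) w + suc ((# L) w)  ≡⟨ ℕ.+-suc _ _ ⟩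
          suc ((# R) w + (# L) w)  ≡⟨ cong suc (ℕ.+-comm ((# R) w) _) ⟩
          suc ((# L) w + (# R) w)  ≡⟨ cong suc (#L+#R w) ⟩
          suc M                    ≡⟨ suc-M ⟩
          b 1                      ∎)) ,
          subst (λ i → StaysInside b i i w) (ℕ.+-comm _ 1) s)

      ∑-wordTerm-suc : ∀ i m k →
        ∑ (words M) (wordTerm (suc i) m k)
          ≡ ∑ (words M) (wordTerm i m k) ⊕ pathSum true M 0 (suc i) (suc i) m k
      ∑-wordTerm-suc i m k =
        trans (∑-cong (words M) (wordTerm-suc i m k))
              (∑-⊕ (words M) (wordTerm i m k) (pathTerm true 0 (suc i) (suc i) m k))

      row-numerator : ∀ {i} → 1 ≤ i → i ≤ r →
        mul-∏ M 0 (rowChains (i , 0)) ≐ pathSum true M 0 i i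
      row-numerator {i} 1≤i i≤r m k =
        trans (mul-∏-cong M 0 (rowChains-diagonal i) m k)
              (rowChains-numerator shape M (position 1≤i i≤r) m k)

      rows-numerator : ∀ i → suc i ≤ r → ∀ m k →
        mul-∏ M 0 (chains (suc i , 0)) m k ≡ ∑ (words M) (wordTerm (suc i) m k)
      rows-numerator zero 1≤r m k = begin
        mul-∏ M 0 (chains (1 , 0)) m k      ≡⟨ mul-∏-cong M 0 chains-top m k ⟩
        mul-∏ M 0 (rowChains (1 , 0)) m k   ≡⟨ row-numerator ℕ.≤-refl 1≤r m k ⟩
        pathSum true M 0 1 1 m k            ≡⟨ ℤ.+-identityˡ _ ⟨
        + 0 ⊕ pathSum true M 0 1 1 m k
          ≡⟨ cong (_⊕ pathSum true M 0 1 1 m k) (∑-0 (words M)) ⟨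
        ∑ (words M) (wordTerm 0 m k) ⊕ pathSum true M 0 1 1 m k
          ≡⟨ ∑-wordTerm-suc 0 m k ⟨
        ∑ (words M) (wordTerm 1 m k)        ∎
      rows-numerator (suc i) i≤r m k = begin
        mul-∏ M 0 (chains (suc (suc i) , 0)) m k
          ≡⟨ mul-∏-cong M 0 (chains-suc (s≤s z≤n)) m k ⟩
        mul-∏ M 0 (chains (suc i , 0) ⊞ rowChains (suc (suc i) , 0)) m k
          ≡⟨ mul-∏-⊞ M 0 (chains (suc i , 0)) (rowChains (suc (suc i) , 0)) m k ⟩
        mul-∏ M 0 (chains (suc i , 0)) m k ⊕ mul-∏ M 0 (rowChains (suc (suc i) , 0)) m k
          ≡⟨ cong₂ _⊕_ (rows-numerator i (ℕ.<⇒≤ i≤r) m k) (row-numerator (s≤s z≤n) i≤r m k) ⟩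
        ∑ (words M) (wordTerm (suc i) m k) ⊕ pathSum true M 0 (suc (suc i)) (suc (suc i)) m k
          ≡⟨ ∑-wordTerm-suc (suc i) m k ⟨
        ∑ (words M) (wordTerm (suc (suc i)) m k) ∎

      suc-pred-r : suc (r ∸ 1) ≡ r
      suc-pred-r = ℕ.m+[n∸m]≡n nonempty

      numerator : mul-∏ M 0 (chains (r , 0)) ≐ ⟦ 𝒟-specialized ⟧
      numerator m k = begin
        mul-∏ M 0 (chains (r , 0)) m k
          ≡⟨ cong (λ r → mul-∏ M 0 (chains (r , 0)) m k) suc-pred-r ⟨
        mul-∏ M 0 (chains (suc (r ∸ 1) , 0)) m k
          ≡⟨ rows-numerator (r ∸ 1) (ℕ.≤-reflexive suc-pred-r) m k ⟩
        ∑ (words M) (wordTerm (suc (r ∸ 1)) m k)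
          ≡⟨ ∑-cong (words M) (λ w → cong₂ when
               (does-⇔ (mk⇔ s≤s (λ { (s≤s l) → l }) ×-⇔ mk⇔ id id)
                        (isGlobalWord? w) (word? (suc (r ∸ 1)) w))
               (cong (λ f → f m k) (global-weight w (descent? w)))) ⟨
        ∑ (words M) (λ w → when (does (isGlobalWord? w)) (mul-qᵃts (λ j → pos j ∸ 1) (D w) m k))
          ≡⟨ ∑-filter isGlobalWord? (words M) (λ w → mul-qᵃts (λ j → pos j ∸ 1) (D w) m k) ⟨
        ∑ 𝒲 (λ w → mul-qᵃts (λ j → pos j ∸ 1) (D w) m k)
          ≡⟨ ⟦eval⟧ (λ j → pos j ∸ 1) (λ j → t⊗q^ (pos j ∸ 1)) 𝒲 D m k ⟨
        ⟦ 𝒟-specialized ⟧ m k ∎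

    global-numerator : IsNumerator F 𝒟-specialized
    global-numerator = isNumerator {f = 𝒟-specialized} refl
      (λ (_ , (_ , i≤r) , _) → i≤r , z≤n) numerator

proposition5p2 : (r : ℕ) (b : ℕ → ℕ) (B : Bounds r b) →
    let open Ferrers B in
    NonnegativeCoefficients (Global.𝒟 r b)
    × IsNumerator F (Global.𝒟-specialized r b)
    × (∀ (x y : FCell) (x<y : x <F y) →
    IsNumerator (interval x y (proj₁ x<y))
    (Local.𝒟-specialized b (row x) (col x) (row y) (col y)))
proposition5p2 r b B =
  ∑∏var-nonneg (Global.𝒲 r b) (Global.D r b) ,
  GlobalNumerator.global-numerator B ,
  λ x y x<y → LocalNumerator.local-numerator B x y (proj₁ x<y)
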